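{- Let $\ell,k\in\mathbb N$ with $\ell\le k$ and $k\ge2$, and let $(M;c)$ be a connected, modular coloured matroid for which $c$ is simple and which has no rainbow triangle. If $|c|=k$, then $M$ has a flat $F$ such that $|c(F)|\le\ell$ and $r_M(F)\ge\frac{\binom{\ell}{2}}{\binom{k}{2}}\,r(M)$.
   Context: A coloured matroid $(M;c)$ is a (finite) matroid $M$ with a function $c$ on $E(M)$; $|c|$ is the number of colours used and $c(F)$ the set of colours on $F$. $c$ is simple if $M$ has no loop and $c(e)=c(f)$ whenever $e,f$ are parallel. $M$ is modular if $r_M(F)+r_M(F')=r_M(F\cup F')+r_M(F\cap F')$ for all flats $F,F'$. A rainbow triangle is a three-element circuit on which $c$ is injective. -}

module Defs where

open import Data.Nat using (ℕ; suc; _+_; _*_; _≤_; _<_)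
open import Data.Fin using (Fin; _≟_)
open import Data.Fin.Subset using (Subset; _∈_; _∉_; _⊆_; _∪_; _∩_; ⁅_⁆; ∣_∣; ⊤)
open import Data.Fin.Subset.Properties using (_∈?_)
open import Data.Fin.Properties using (any?)
open import Data.Vec using (tabulate)
open import Data.Product using (Σ; ∃; _×_; _,_)
open import Relation.Nullary using (¬_; does)
open import Relation.Nullary.Decidable using (_×-dec_)
open import Relation.Binary.PropositionalEquality using (_≡_; _≢_)

record Matroid (n : ℕ) : Set where
  field
    r        : Subset n → ℕ
    r-bound  : ∀ X → r X ≤ ∣ X ∣
    r-mono   : ∀ X Y → X ⊆ Y → r X ≤ r Y
    r-submod : ∀ X Y → r (X ∪ Y) + r (X ∩ Y) ≤ r X + r Y
open Matroid public

module _ {n : ℕ} (M : Matroid n) where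

  rankM : ℕ
  rankM = r M ⊤

  IsFlat : Subset n → Set
  IsFlat F = ∀ e → e ∉ F → r M F < r M (F ∪ ⁅ e ⁆)

  Dependent : Subset n → Set
  Dependent X = r M X < ∣ X ∣

  IsCircuit : Subset n → Set
  IsCircuit C = Dependent C × (∀ X → X ⊆ C → X ≢ C → ¬ Dependent X)

  Connected : Set
  Connected = ∀ e f → e ≢ f → Σ (Subset n) λ C → IsCircuit C × e ∈ C × f ∈ C

  IsLoop : Fin n → Set
  IsLoop e = r M ⁅ e ⁆ ≡ 0

  Parallel : Fin n → Fin n → Set
  Parallel e f = e ≢ f × IsCircuit (⁅ e ⁆ ∪ ⁅ f ⁆)

  Modular : Set
  Modular = ∀ F F' → IsFlat F → IsFlat F' → r M F + r M F' ≡ r M (F ∪ F') + r M (F ∩ F')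

image : {n m : ℕ} → (Fin n → Fin m) → Subset n → Subset m
image {n} c F = tabulate λ j → does (any? (λ e → (e ∈? F) ×-dec (c e ≟ j)))

numColours : {n m : ℕ} → (Fin n → Fin m) → ℕ
numColours c = ∣ image c ⊤ ∣

module _ {n m : ℕ} (M : Matroid n) (c : Fin n → Fin m) where

  SimpleColouring : Set
  SimpleColouring = (∀ e → ¬ IsLoop M e) × (∀ e f → Parallel M e f → c e ≡ c f)

  RainbowTriangle : Subset n → Set
  RainbowTriangle T = IsCircuit M T × ∣ T ∣ ≡ 3
                      × (∀ e f → e ∈ T → f ∈ T → c e ≡ c f → e ≡ f)

  NoRainbowTriangle : Set
  NoRainbowTriangle = ∀ T → ¬ RainbowTriangle T

-- A Gallai-type decomposition.  Modularity and connectedness turn M into a projective geometry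
-- whose lines have at least three points, and the absence of rainbow triangles says that every
-- line has at most two colours.
--
-- (1) If the points of a flat K are coloured with three colours, one colour class spans a proper
--     flat of K.  In a plane this is a finiteness argument: a projectivity of a line that maps
--     the points of one colour into themselves must permute them.  (Infinite planes have
--     three-colourings without rainbow lines in which every class spans, for example Monsky's
--     colouring by 2-adic valuations.)  In higher rank one inducts along a hyperplane.
-- (2) If a colour class spans a proper flat Q, colours are constant on the cosets of Q, so a
--     complement of Q is a coloured copy of the quotient by Q.  By induction, every nonempty
--     flat K has a proper flat F such that K ∖ F uses at most two colours.
-- (3) Iterating gives a chain of flats whose successive differences use at most two colours
--     each.  For a set S of colours, modularity lets the layers with colours in S be assembled
--     into a flat with colours in S whose rank is at least the sum of the rank increments.
-- (4) Each layer carries at most two colours, so among s colours one can be dropped at the cost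
--     of a fraction 2 / s of the total weight; dropping colours down to ℓ leaves the fraction
--     (ℓ C 2) / (k C 2).

module Submission where

open import Defs
open import Data.Bool using (true; false)
open import Data.Nat using (ℕ; zero; suc; _+_; _*_; _∸_; _≤_; _<_; z≤n; s≤s; NonZero; >-nonZero)
open import Data.Nat.Combinatorics using (_C_; nCk+nC[k+1]≡[n+1]C[k+1]; nC1≡n)
open import Data.Nat.Induction using (<-wellFounded)
open import Data.Nat.Properties as ℕ
  using ( ≤-refl; ≤-trans; ≤-reflexive; +-mono-≤; +-cancelʳ-≤; +-monoʳ-≤; <⇒≱; ≰⇒>; ≮⇒≥
        ; m≤m+n; +-comm; +-suc; +-identityʳ; n<1+n; m≤n⇒∃[o]m+o≡n; ∸-monoʳ-<; module ≤-Reasoning)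
open import Data.Nat.Tactic.RingSolver using (solve-∀)
open import Data.Fin using (Fin; zero; suc; toℕ; _≟_)
open import Data.Fin.Properties using (any?; pigeonhole)
open import Data.Fin.Subset
open import Data.Fin.Subset.Properties
open import Data.Vec using ([]; _∷_; tabulate; here; there)
open import Data.Vec.Properties using (lookup∘tabulate; []=⇒lookup; lookup⇒[]=)
open import Data.List using (List; []; _∷_; filter; allFin)
open import Data.List.Membership.Propositional using () renaming (_∈_ to _∈ˡ_)
open import Data.List.Membership.Propositional.Properties using (∈-filter⁺; ∈-allFin)
open import Data.List.Relation.Unary.All as All using (All; []; _∷_)
open import Data.List.Relation.Unary.All.Properties using (all-filter)
open import Data.List.Relation.Unary.Any using (here; there)
open import Data.Product using (Σ; Σ-syntax; ∃; _×_; _,_; proj₁; proj₂)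
open import Data.Sum as Sum using (_⊎_; inj₁; inj₂)
open import Data.Empty using () renaming (⊥ to ∅; ⊥-elim to absurd)
open import Algebra.Properties.CommutativeSemigroup ℕ.+-commutativeSemigroup using (interchange)
open import Algebra.Properties.CommutativeSemigroup ℕ.*-commutativeSemigroup using (x∙yz≈y∙xz)
open import Function using (_∘_; id)
open import Induction.WellFounded using (Acc; acc)
open import Relation.Nullary using (¬_; Dec; yes; no; does)
open import Relation.Nullary.Decidable using (_×-dec_; ¬?; dec-true; decidable-stable)
open import Relation.Binary.PropositionalEquality
  using (_≡_; _≢_; refl; sym; trans; cong; cong₂; subst; ≢-sym; module ≡-Reasoning)

-- Subsets from decidable predicates and from lists

module _ {n : ℕ} {P : Fin n → Set} (P? : ∀ x → Dec (P x)) where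

  sieve : Subset n
  sieve = tabulate (λ x → does (P? x))

  ∈-sieve⁺ : ∀ {x} → P x → x ∈ sieve
  ∈-sieve⁺ {x} px = lookup⇒[]= x sieve (trans (lookup∘tabulate _ x) (dec-true (P? x) px))

  ∈-sieve⁻ : ∀ {x} → x ∈ sieve → P x
  ∈-sieve⁻ {x} x∈ with P? x | trans (sym (lookup∘tabulate (λ y → does (P? y)) x)) ([]=⇒lookup x∈)
  ... | yes px | _ = px

∪-⊆ : ∀ {n} {X Y Z : Subset n} → X ⊆ Z → Y ⊆ Z → X ∪ Y ⊆ Z
∪-⊆ {X = X} {Y} X⊆Z Y⊆Z x∈ with x∈p∪q⁻ X Y x∈
... | inj₁ x∈X = X⊆Z x∈X
... | inj₂ x∈Y = Y⊆Z x∈Y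

⁅⁆⊆ : ∀ {n} {x : Fin n} {X : Subset n} → x ∈ X → ⁅ x ⁆ ⊆ X
⁅⁆⊆ {x = x} {X} x∈X y∈ = subst (_∈ X) (sym (x∈⁅y⁆⇒x≡y x y∈)) x∈X

fromList : ∀ {n} → List (Fin n) → Subset n
fromList []       = ⊥
fromList (x ∷ xs) = fromList xs ∪ ⁅ x ⁆

∈-fromList⁺ : ∀ {n} {x : Fin n} {xs} → x ∈ˡ xs → x ∈ fromList xs
∈-fromList⁺ {xs = y ∷ ys} (here refl) = q⊆p∪q (fromList ys) ⁅ y ⁆ (x∈⁅x⁆ y)
∈-fromList⁺ {xs = y ∷ ys} (there x∈)  = p⊆p∪q ⁅ y ⁆ (∈-fromList⁺ x∈)

elements : ∀ {n} → Subset n → List (Fin n)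
elements X = filter (_∈? X) (allFin _)

elements-∈ : ∀ {n} (X : Subset n) → All (_∈ X) (elements X)
elements-∈ X = all-filter (_∈? X) (allFin _)

⊆-elements : ∀ {n} (X : Subset n) → X ⊆ fromList (elements X)
⊆-elements X {x} x∈X = ∈-fromList⁺ (∈-filter⁺ (_∈? X) (∈-allFin x) x∈X)

-- Projective geometries

-- Parallel elements are not identified, so the points of the geometry are the `∥`-classes. `join`
-- is modularity, with `f` and `g` witnessing that both flats are nonempty, and `third` is what
-- connectedness provides.
record ProjectiveGeometry (n : ℕ) : Set where
  field
    cl       : Subset n → Subset n
    cl-ext   : ∀ {X} → X ⊆ cl X
    cl-least : ∀ {X Y} → X ⊆ cl Y → cl X ⊆ cl Y
    exchange : ∀ {X x y} → y ∈ cl (X ∪ ⁅ x ⁆) → y ∉ cl X → x ∈ cl (X ∪ ⁅ y ⁆)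
    loopless : ∀ {x} → x ∉ cl ⊥

  line : Fin n → Fin n → Subset n
  line x y = cl (⁅ x ⁆ ∪ ⁅ y ⁆)

  Flat : Subset n → Set
  Flat F = cl F ⊆ F

  infix 4 _∥_
  _∥_ : Fin n → Fin n → Set
  x ∥ y = y ∈ cl ⁅ x ⁆

  field
    join  : ∀ {F G f g z} → Flat F → Flat G → f ∈ F → g ∈ G → z ∈ cl (F ∪ G) →
            Σ[ f′ ∈ Fin n ] Σ[ g′ ∈ Fin n ] f′ ∈ F × g′ ∈ G × z ∈ line f′ g′
    third : ∀ {x y} → ¬ x ∥ y → Σ[ z ∈ Fin n ] z ∈ line x y × ¬ x ∥ z × ¬ y ∥ z

module Incidence {n : ℕ} (Γ : ProjectiveGeometry n) where
  open ProjectiveGeometry Γ public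

  infixl 6 _⊕_
  _⊕_ : Subset n → Fin n → Subset n
  F ⊕ x = cl (F ∪ ⁅ x ⁆)

  cl-flat : ∀ {X} → Flat (cl X)
  cl-flat = cl-least (λ x∈ → x∈)

  cl-min : ∀ {X F} → Flat F → X ⊆ F → cl X ⊆ F
  cl-min fF X⊆F x∈ = fF (cl-least (λ y∈ → cl-ext (X⊆F y∈)) x∈)

  flat-⊥ : Flat ⊥
  flat-⊥ x∈ = absurd (loopless x∈)

  line-left : ∀ {x y} → x ∈ line x y
  line-left {x} {y} = cl-ext (p⊆p∪q ⁅ y ⁆ (x∈⁅x⁆ x))

  line-right : ∀ {x y} → y ∈ line x y
  line-right {x} {y} = cl-ext (q⊆p∪q ⁅ x ⁆ ⁅ y ⁆ (x∈⁅x⁆ y))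

  line-⊆ : ∀ {F x y} → Flat F → x ∈ F → y ∈ F → line x y ⊆ F
  line-⊆ fF x∈F y∈F = cl-min fF (∪-⊆ (⁅⁆⊆ x∈F) (⁅⁆⊆ y∈F))

  line-sym : ∀ {x y} → line x y ⊆ line y x
  line-sym = line-⊆ cl-flat line-right line-left

  ⊕-base : ∀ {F x} → F ⊆ F ⊕ x
  ⊕-base {F} {x} y∈F = cl-ext (p⊆p∪q ⁅ x ⁆ y∈F)

  ⊕-point : ∀ {F x} → x ∈ F ⊕ x
  ⊕-point {F} {x} = cl-ext (q⊆p∪q F ⁅ x ⁆ (x∈⁅x⁆ x))

  ⊕-⊆ : ∀ {F G x} → Flat G → F ⊆ G → x ∈ G → F ⊕ x ⊆ G
  ⊕-⊆ fG F⊆G x∈G = cl-min fG (∪-⊆ F⊆G (⁅⁆⊆ x∈G))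

  ⊕-exchange : ∀ {F x y} → Flat F → y ∈ F ⊕ x → y ∉ F → x ∈ F ⊕ y
  ⊕-exchange fF y∈ y∉F = exchange y∈ (y∉F ∘ fF)

  flat-∥ : ∀ {F x y} → Flat F → x ∥ y → x ∈ F → y ∈ F
  flat-∥ fF x∥y x∈F = cl-min fF (⁅⁆⊆ x∈F) x∥y

  ∥-refl : ∀ {x} → x ∥ x
  ∥-refl {x} = cl-ext (x∈⁅x⁆ x)

  ∥-sym : ∀ {x y} → x ∥ y → y ∥ x
  ∥-sym {x} {y} x∥y = cl-least (∪-⊆ (λ z∈ → absurd (∉⊥ z∈)) (⁅⁆⊆ ∥-refl))
    (exchange (cl-least (λ z∈ → cl-ext (q⊆p∪q ⊥ ⁅ x ⁆ z∈)) x∥y) loopless)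

  ∥-trans : ∀ {x y z} → x ∥ y → y ∥ z → x ∥ z
  ∥-trans x∥y y∥z = flat-∥ cl-flat y∥z x∥y

  _∥?_ : ∀ x y → Dec (x ∥ y)
  x ∥? y = y ∈? cl ⁅ x ⁆

  ∥⇒∈line : ∀ {x y z} → x ∥ z → z ∈ line x y
  ∥⇒∈line x∥z = flat-∥ cl-flat x∥z line-left

  ∉⇒∦ : ∀ {F x y} → Flat F → x ∈ F → y ∉ F → ¬ x ∥ y
  ∉⇒∦ fF x∈F y∉F x∥y = y∉F (flat-∥ fF x∥y x∈F)

  ∉⇒∦′ : ∀ {F x y} → Flat F → x ∉ F → y ∈ F → ¬ x ∥ y
  ∉⇒∦′ fF x∉F y∈F x∥y = x∉F (flat-∥ fF (∥-sym x∥y) y∈F)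

  line-exchange : ∀ {x y z} → z ∈ line x y → ¬ x ∥ z → y ∈ line x z
  line-exchange = exchange

  line-⊆-flat : ∀ {F x y z} → Flat F → x ∈ F → z ∈ F → z ∈ line x y → ¬ x ∥ z → y ∈ F
  line-⊆-flat fF x∈F z∈F z∈ x∦z = line-⊆ fF x∈F z∈F (line-exchange z∈ x∦z)

  line-span : ∀ {x y z w} → z ∈ line x y → w ∈ line x y → ¬ z ∥ w → line x y ⊆ line z w
  line-span {x} {y} {z} {w} z∈ w∈ z∦w = line-⊆ cl-flat (first z∈ w∈) (first (line-sym z∈) (line-sym w∈))
    where
    first : ∀ {x y} → z ∈ line x y → w ∈ line x y → x ∈ line z w
    first {x} {y} z∈ w∈ with x ∥? z
    ... | yes x∥z = ∥⇒∈line (∥-sym x∥z)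
    ... | no x∦z  = line-exchange (line-sym (line-⊆ cl-flat line-left (line-exchange z∈ x∦z) w∈)) z∦w

  -- Two non-parallel points of `F` on the line `p q` would put the whole line, hence `p`, into `F`.
  meet-unique : ∀ {F p q x y} → Flat F → p ∉ F → x ∈ F → y ∈ F → x ∈ line p q → y ∈ line p q → x ∥ y
  meet-unique {x = x} {y} fF p∉F x∈F y∈F x∈ y∈ = decidable-stable (x ∥? y)
    λ x∦y → p∉F (line-⊆ fF x∈F y∈F (line-span x∈ y∈ x∦y line-left))

  -- Each `y` is the image of the corresponding `x` under projection from `p`. When the images
  -- agree, `x₁` and `x₂` both lie on the line `p y₁`, which meets `F` in one point only.
  perspective-injective : ∀ {F p x₁ x₂ y₁ y₂} → Flat F → p ∉ F → x₁ ∈ F → x₂ ∈ F →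
    y₁ ∈ line p x₁ → y₂ ∈ line p x₂ → ¬ p ∥ y₁ → y₁ ∥ y₂ → x₁ ∥ x₂
  perspective-injective fF p∉F x₁∈F x₂∈F y₁∈ y₂∈ p∦y₁ y₁∥y₂ =
    meet-unique fF p∉F x₁∈F x₂∈F (line-exchange y₁∈ p∦y₁)
      (line-⊆ cl-flat line-left (flat-∥ cl-flat y₁∥y₂ line-right)
        (line-exchange y₂∈ λ p∥y₂ → p∦y₁ (∥-trans p∥y₂ (∥-sym y₁∥y₂))))

  join-point : ∀ {F f x z} → Flat F → f ∈ F → z ∈ F ⊕ x → Σ[ g ∈ Fin n ] g ∈ F × z ∈ line g x
  join-point {F} {f} {x} fF f∈F z∈
    with g , y , g∈F , x∥y , z∈gy ← join fF cl-flat f∈F (∥-refl {x})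
           (cl-least (∪-⊆ (cl-ext ∘ p⊆p∪q _) (cl-ext ∘ q⊆p∪q F _ ∘ cl-ext)) z∈)
    = g , g∈F , line-⊆ cl-flat line-left (flat-∥ cl-flat x∥y line-right) z∈gy

  -- The generators are adjoined one at a time, and `join-point` puts each new point on a line
  -- through the last generator and an earlier point.
  cl-induction : ∀ {X} {Q : Fin n → Set} → (∀ {x} → x ∈ X → Q x) →
    (∀ {x y z} → Q x → Q y → z ∈ line x y → Q z) → ∀ {z} → z ∈ cl X → Q z
  cl-induction {X} {Q} base step z∈ =
    go (elements X) (All.map base (elements-∈ X)) (cl-least (cl-ext ∘ ⊆-elements X) z∈)
    where
    go : ∀ xs → All Q xs → ∀ {z} → z ∈ cl (fromList xs) → Q z
    go []       _        z∈ = absurd (loopless z∈)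
    go (x ∷ xs) (q ∷ qs) z∈ with nonempty? (cl (fromList xs))
    ... | yes (f , f∈)
          with g , g∈ , z∈gx ← join-point cl-flat f∈
                 (cl-least (∪-⊆ (⊕-base ∘ cl-ext) (⁅⁆⊆ ⊕-point)) z∈)
          = step (go xs qs g∈) q z∈gx
    -- Nothing has been spanned yet, so `z` is parallel to `x` and lies on the degenerate line
    -- `x x`.
    ... | no empty = step q q
          (cl-least (∪-⊆ (λ w → absurd (empty (_ , cl-ext w))) (cl-ext ∘ p⊆p∪q _)) z∈)

-- Complements, hyperplanes and absorbed cosets

module Subspaces {n : ℕ} (Γ : ProjectiveGeometry n) where
  open Incidence Γ public

  record Complement (G F K : Subset n) : Set where
    field
      set    : Subset n
      flat   : Flat set
      above  : G ⊆ set
      below  : set ⊆ K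
      meet   : ∀ {x} → x ∈ set → x ∈ F → x ∈ G
      spans  : K ⊆ cl (set ∪ F)

  abstract
    -- Points of `K` outside the span of `X` and `F` are adjoined to `X` while there are any. By
    -- exchange no such step puts a new point of `F` into `X`.
    complement : ∀ {G F K} → Flat G → Flat F → Flat K → G ⊆ K → Complement G F K
    complement {G} {F} {K} fG fF fK G⊆K = go G (<-wellFounded _) fG (λ x∈ → x∈) G⊆K (λ x∈G _ → x∈G)
      where
      go : ∀ X → Acc _<_ (n ∸ ∣ X ∣) → Flat X → G ⊆ X → X ⊆ K →
           (∀ {x} → x ∈ X → x ∈ F → x ∈ G) → Complement G F K
      go X (acc rec) fX G⊆X X⊆K X∩F with any? (λ z → (z ∈? K) ×-dec ¬? (z ∈? cl (X ∪ F)))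
      ... | no ¬z = record
            { set = X ; flat = fX ; above = G⊆X ; below = X⊆K ; meet = X∩F
            ; spans = λ {z} z∈K → decidable-stable (z ∈? cl (X ∪ F)) λ z∉ → ¬z (z , z∈K , z∉) }
      ... | yes (z , z∈K , z∉) =
            go (X ⊕ z) (rec (∸-monoʳ-< bigger (∣p∣≤n (X ⊕ z)))) cl-flat (⊕-base ∘ G⊆X) (⊕-⊆ fK X⊆K z∈K) X⊕z∩F
        where
        bigger : ∣ X ∣ < ∣ X ⊕ z ∣
        bigger = p⊂q⇒∣p∣<∣q∣ (⊕-base , z , ⊕-point , λ z∈X → z∉ (cl-ext (p⊆p∪q F z∈X)))
        X⊕z∩F : ∀ {x} → x ∈ X ⊕ z → x ∈ F → x ∈ G
        X⊕z∩F {x} x∈ x∈F with x ∈? X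
        ... | yes x∈X = X∩F x∈X x∈F
        ... | no x∉X  = absurd (z∉ (⊕-⊆ cl-flat (cl-ext ∘ p⊆p∪q F) (cl-ext (q⊆p∪q X F x∈F)) (⊕-exchange fX x∈ x∉X)))

  record Hyperplane (K H : Subset n) : Set where
    field
      flat  : Flat H
      below : H ⊆ K
      spans : ∀ {z} → z ∈ K → z ∉ H → K ⊆ H ⊕ z

  abstract
    -- A complement of the point `y` in `K` above `F` works: adjoining `y` to it gives all of `K`,
    -- and by exchange so does adjoining any other point of `K` outside it.
    hyperplane-avoiding : ∀ {F K y} → Flat F → Flat K → F ⊆ K → y ∈ K → y ∉ F →
      Σ[ H ∈ Subset n ] Hyperplane K H × F ⊆ H × y ∉ H
    hyperplane-avoiding {F} {K} {y} fF fK F⊆K y∈K y∉F =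
      set , record { flat = flat ; below = below ; spans = hyper } , above , y∉set
      where
      open Complement (complement {F} {cl ⁅ y ⁆} fF cl-flat fK F⊆K)
      y∉set : y ∉ set
      y∉set y∈ = y∉F (meet y∈ ∥-refl)
      spans-y : K ⊆ set ⊕ y
      spans-y = cl-min cl-flat (∪-⊆ ⊕-base (cl-min cl-flat (⁅⁆⊆ ⊕-point))) ∘ spans
      hyper : ∀ {z} → z ∈ K → z ∉ set → K ⊆ set ⊕ z
      hyper z∈K z∉ = ⊕-⊆ cl-flat ⊕-base (⊕-exchange flat (spans-y z∈K) z∉) ∘ spans-y

  module _ {K H : Subset n} (hyp : Hyperplane K H) {o : Fin n} (o∈H : o ∈ H) where
    open Hyperplane hyp

    abstract
      meets-hyperplane : ∀ {p q} → p ∈ K → q ∈ K → ¬ p ∥ q → Σ[ x ∈ Fin n ] x ∈ line p q × x ∈ H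
      meets-hyperplane {p} {q} p∈K q∈K p∦q with p ∈? H
      ... | yes p∈H = p , line-left , p∈H
      ... | no p∉H with f , f∈H , q∈ ← join-point flat o∈H (spans p∈K p∉H q∈K)
          = f , line-exchange (line-sym q∈) p∦q , f∈H

  -- If one line of K is a hyperplane then K is a plane, and all of its lines are hyperplanes.
  abstract
    line-hyperplane : ∀ {K u v p q} → Flat K → Hyperplane K (line u v) → p ∈ K → q ∈ K → ¬ p ∥ q →
      Hyperplane K (line p q)
    line-hyperplane {K} {u} {v} {p} {q} fK hyp p∈K q∈K p∦q = record
      { flat = cl-flat ; below = line-⊆ fK p∈K q∈K ; spans = spans′ }
      where
      module L = Hyperplane hyp
      spans-from : ∀ {s z} → s ∈ K → s ∈ line p q → s ∉ line u v → z ∈ K → z ∉ line p q → K ⊆ line p q ⊕ z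
      spans-from {s} {z} s∈K s∈ s∉ z∈K z∉
        with f , f∈pq , f∈uv ← meets-hyperplane hyp line-left p∈K q∈K p∦q
        with f′ , f′∈uv , z∈ ← join-point L.flat line-left (L.spans s∈K s∉ z∈K)
        = ⊕-⊆ cl-flat (line-⊆ cl-flat (⊕-base f∈pq) f′∈ ∘ line-span f∈uv f′∈uv f∦f′) (⊕-base s∈) ∘ L.spans s∈K s∉
        where
        f′∈ : f′ ∈ line p q ⊕ z
        f′∈ = line-⊆-flat cl-flat (⊕-base s∈) ⊕-point (line-sym z∈) (∉⇒∦ cl-flat s∈ z∉)
        f∦f′ : ¬ f ∥ f′
        f∦f′ f∥f′ = z∉ (line-⊆ cl-flat (flat-∥ cl-flat f∥f′ f∈pq) s∈ z∈)
      spans′ : ∀ {z} → z ∈ K → z ∉ line p q → K ⊆ line p q ⊕ z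
      spans′ z∈K z∉ with p ∈? line u v | q ∈? line u v
      ... | no p∉  | _      = spans-from p∈K line-left p∉ z∈K z∉
      ... | yes _  | no q∉  = spans-from q∈K line-right q∉ z∈K z∉
      ... | yes p∈ | yes q∈ = ⊕-⊆ cl-flat (⊕-base ∘ uv⊆pq) ⊕-point ∘ L.spans z∈K (z∉ ∘ uv⊆pq)
        where
        uv⊆pq : line u v ⊆ line p q
        uv⊆pq = line-span p∈ q∈ p∦q

  -- The coset of y through z is the line y z without y.
  record Absorbs (S : Fin n → Set) (y : Fin n) : Set where
    constructor absorbs
    field
      disjoint : ¬ S y
      coset    : ∀ {z z′} → S z → z′ ∈ line y z → ¬ y ∥ z′ → S z′
  open Absorbs

  abstract
    -- For `w` not parallel to `y₁`, a coset move through `w` is a move through `y₁` followed by one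
    -- through `y₂`; on the line `y₁ y₂` itself, one of the two suffices.
    absorbs-line : ∀ {S : Fin n → Set} → (∀ {x y} → x ∥ y → S x → S y) →
      ∀ {y₁ y₂ w} → Absorbs S y₁ → Absorbs S y₂ → w ∈ line y₁ y₂ → Absorbs S w
    absorbs-line {S} S-∥ {y₁} {y₂} {w} N₁ N₂ w∈ with y₁ ∥? w
    ... | yes y₁∥w = absorbs (disjoint N₁ ∘ S-∥ (∥-sym y₁∥w)) λ Sz z′∈ w∦z′ →
            coset N₁ Sz (line-⊆ cl-flat (flat-∥ cl-flat y₁∥w line-left) line-right z′∈)
                        (λ y₁∥z′ → w∦z′ (∥-trans (∥-sym y₁∥w) y₁∥z′))
    ... | no y₁∦w = absorbs w∉S cos
      where
      y₁∦y₂ : ¬ y₁ ∥ y₂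
      y₁∦y₂ y₁∥y₂ = y₁∦w (line-⊆ cl-flat ∥-refl y₁∥y₂ w∈)
      w∉S : ¬ S w
      w∉S Sw = disjoint N₂ (coset N₁ Sw (line-exchange w∈ y₁∦w) y₁∦y₂)
      cos : ∀ {z z′} → S z → z′ ∈ line w z → ¬ w ∥ z′ → S z′
      cos {z} {z′} Sz z′∈ w∦z′ with z ∈? line y₁ y₂
      cos {z} {z′} Sz z′∈ w∦z′ | yes z∈ with y₁ ∥? z′
      ... | no y₁∦z′ = coset N₁ Sz (line-span line-left z∈ y₁∦z z′∈y₁y₂) y₁∦z′
        where
        y₁∦z : ¬ y₁ ∥ z
        y₁∦z y₁∥z = disjoint N₁ (S-∥ (∥-sym y₁∥z) Sz)
        z′∈y₁y₂ : z′ ∈ line y₁ y₂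
        z′∈y₁y₂ = line-⊆ cl-flat w∈ z∈ z′∈
      ... | yes y₁∥z′ = coset N₂ Sz (line-span line-right z∈ y₂∦z z′∈y₁y₂)
                          (λ y₂∥z′ → y₁∦y₂ (∥-trans y₁∥z′ (∥-sym y₂∥z′)))
        where
        y₂∦z : ¬ y₂ ∥ z
        y₂∦z y₂∥z = disjoint N₂ (S-∥ (∥-sym y₂∥z) Sz)
        z′∈y₁y₂ : z′ ∈ line y₁ y₂
        z′∈y₁y₂ = line-⊆ cl-flat w∈ z∈ z′∈
      cos {z} {z′} Sz z′∈ w∦z′ | no z∉
        -- In the plane of `y₁`, `y₂` and `z`, the lines `y₁ z` and `y₂ z′` meet in `m`.
        with m , m∈ , z′∈my₂ ← join-point cl-flat line-left
               (line-⊆ (cl-flat {line y₁ z ∪ ⁅ y₂ ⁆}) (line-⊆ cl-flat (⊕-base line-left) ⊕-point w∈)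
                  (⊕-base line-right) z′∈)
        = coset N₂ (coset N₁ Sz m∈ y₁∦m) (line-sym z′∈my₂) (∉⇒∦ cl-flat line-right z′∉)
        where
        z′∉ : z′ ∉ line y₁ y₂
        z′∉ z′∈y₁y₂ = z∉ (line-⊆-flat cl-flat w∈ z′∈y₁y₂ z′∈ w∦z′)
        y₁∦m : ¬ y₁ ∥ m
        y₁∦m y₁∥m = z′∉ (line-⊆ cl-flat (∥⇒∈line y₁∥m) line-right z′∈my₂)

  abstract
    absorbs-cl : ∀ {X} {S : Fin n → Set} → (∀ {x y} → x ∥ y → S x → S y) →
      (∀ {y} → y ∈ X → Absorbs S y) → ∀ {y} → y ∈ cl X → Absorbs S y
    absorbs-cl S-∥ base = cl-induction base (absorbs-line S-∥)

  abstract
    -- Two iterates of t coincide, and cancelling f closes up the orbit at t.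
    injective⇒surjective : {T : Set} (pt : T → Fin n) (f : T → T) →
      (∀ s t → pt (f s) ∥ pt (f t) → pt s ∥ pt t) → ∀ t → Σ[ s ∈ T ] pt (f s) ∥ pt t
    injective⇒surjective {T} pt f inj t =
      iter (proj₁ (proj₂ gap)) , ∥-sym (cancel (proj₁ gap) (proj₁ (proj₂ gap)) (proj₂ (proj₂ gap)))
      where
      iter : ℕ → T
      iter zero    = t
      iter (suc i) = f (iter i)
      cancel : ∀ i o → pt (iter i) ∥ pt (iter (suc i + o)) → pt t ∥ pt (iter (suc o))
      cancel zero    o eq = eq
      cancel (suc i) o eq = cancel i o (inj _ _ eq)
      gap : Σ[ i ∈ ℕ ] Σ[ o ∈ ℕ ] pt (iter i) ∥ pt (iter (suc i + o))
      gap with i , j , i<j , eq ← pigeonhole (n<1+n n) (pt ∘ iter ∘ toℕ)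
          with o , i+o≡j ← m≤n⇒∃[o]m+o≡n i<j
        = toℕ i , o , subst (λ j → pt (iter (toℕ i)) ∥ pt (iter j)) (sym i+o≡j)
                            (subst (pt (iter (toℕ i)) ∥_) eq ∥-refl)

-- Colourings whose lines have at most two colours

record RainbowFree {n m : ℕ} (Γ : ProjectiveGeometry n) (κ : Fin n → Fin m) : Set where
  open ProjectiveGeometry Γ
  field
    parallel-colour : ∀ {x y} → x ∥ y → κ x ≡ κ y
    line-colour     : ∀ {x y z} → κ x ≢ κ y → z ∈ line x y → κ z ≡ κ x ⊎ κ z ≡ κ y

module Coloured {n m : ℕ} {Γ : ProjectiveGeometry n} {κ : Fin n → Fin m} (rf : RainbowFree Γ κ) where
  open Subspaces Γ public
  open RainbowFree rf public

  κ-∦ : ∀ {x y i j} → κ x ≡ i → κ y ≡ j → i ≢ j → ¬ x ∥ y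
  κ-∦ κx κy i≢j x∥y = i≢j (trans (sym κx) (trans (parallel-colour x∥y) κy))

  two-coloured : ∀ {x y z i j} → κ x ≡ i → κ y ≡ j → i ≢ j → z ∈ line x y → κ z ≡ i ⊎ κ z ≡ j
  two-coloured refl refl = line-colour

  third-∉ : ∀ {x y z i j k} → κ x ≡ i → κ y ≡ j → κ z ≡ k → i ≢ j → i ≢ k → j ≢ k → z ∉ line x y
  third-∉ κx κy κz i≢j i≢k j≢k z∈ with two-coloured κx κy i≢j z∈
  ... | inj₁ κz′ = i≢k (trans (sym κz′) κz)
  ... | inj₂ κz′ = j≢k (trans (sym κz′) κz)

  common-colour : ∀ {p q s t z i j k} →
                  κ p ≡ i → κ q ≡ k → κ s ≡ j → κ t ≡ k → i ≢ j → i ≢ k → j ≢ k →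
                  z ∈ line p q → z ∈ line s t → κ z ≡ k
  common-colour κp κq κs κt i≢j i≢k j≢k z∈pq z∈st
    with two-coloured κp κq i≢k z∈pq | two-coloured κs κt j≢k z∈st
  ... | inj₂ κz | _        = κz
  ... | inj₁ _  | inj₂ κz  = κz
  ... | inj₁ κz | inj₁ κz′ = absurd (i≢j (trans (sym κz) κz′))

  -- Requiring every line to be a hyperplane is what makes any two lines of `K` meet.
  record Plane (K : Subset n) : Set where
    field
      flat  : Flat K
      lines : ∀ {p q} → p ∈ K → q ∈ K → ¬ p ∥ q → Hyperplane K (line p q)

    meet : ∀ {p q s t} → p ∈ K → q ∈ K → s ∈ K → t ∈ K → ¬ p ∥ q → ¬ s ∥ t →
           Σ[ z ∈ Fin n ] z ∈ line p q × z ∈ line s t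
    meet p∈ q∈ s∈ t∈ p∦q s∦t = meets-hyperplane (lines s∈ t∈ s∦t) line-left p∈ q∈ p∦q

  -- Projectivities in a three-coloured plane

  module PlaneColours {K : Subset n} (plane : Plane K) {a b c : Fin m} (a≢b : a ≢ b) (a≢c : a ≢ c) (b≢c : b ≢ c) where
    open Plane plane

    private
      c≢a = ≢-sym a≢c
      c≢b = ≢-sym b≢c
      b≢a = ≢-sym a≢b

    -- The projectivity L → line v z₀ → line v a₀ → L of the line L = line u v, with centres
    -- c₀, u, c₀, maps the points of colour a on L to points of colour a.  As there are only
    -- finitely many of those, its inverse does so as well.
    module Projectivity {u v c₀ z₀ a₀ : Fin n}
      (u∈K : u ∈ K) (v∈K : v ∈ K) (c₀∈K : c₀ ∈ K) (z₀∈K : z₀ ∈ K) (a₀∈K : a₀ ∈ K)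
      (κu : κ u ≡ a) (κv : κ v ≡ b) (κc₀ : κ c₀ ≡ c) (κz₀ : κ z₀ ≡ c) (κa₀ : κ a₀ ≡ a)
      (c₀∉ : c₀ ∉ line v z₀) (a₀∉ : a₀ ∉ line u v)
      where

      record Step (d e : Fin n) : Set where
        field
          d∈L : d ∈ line u v
          e∈L : e ∈ line u v
          z y : Fin n
          z∈c₀d : z ∈ line c₀ d
          z∈vz₀ : z ∈ line v z₀
          y∈uz : y ∈ line u z
          y∈va₀ : y ∈ line v a₀
          e∈c₀y : e ∈ line c₀ y

      c₀∉L : c₀ ∉ line u v
      c₀∉L = third-∉ κu κv κc₀ a≢b a≢c b≢c

      u∉vz₀ : u ∉ line v z₀
      u∉vz₀ = third-∉ κv κz₀ κu b≢c b≢a c≢a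

      c₀∉va₀ : c₀ ∉ line v a₀
      c₀∉va₀ = third-∉ κv κa₀ κc₀ b≢a b≢c a≢c

      u∉va₀ : u ∉ line v a₀
      u∉va₀ u∈ = a₀∉ (line-sym (line-exchange u∈ (κ-∦ κv κu b≢a)))

      step-injective : ∀ {d₁ d₂ e₁ e₂} → Step d₁ e₁ → Step d₂ e₂ → e₁ ∥ e₂ → d₁ ∥ d₂
      step-injective S₁ S₂ e₁∥e₂ =
        perspective-injective cl-flat c₀∉L S₁.d∈L S₂.d∈L S₁.z∈c₀d S₂.z∈c₀d (∉⇒∦′ cl-flat c₀∉ S₁.z∈vz₀)
        (perspective-injective cl-flat u∉vz₀ S₁.z∈vz₀ S₂.z∈vz₀ S₁.y∈uz S₂.y∈uz (∉⇒∦′ cl-flat u∉va₀ S₁.y∈va₀)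
        (perspective-injective cl-flat c₀∉va₀ S₁.y∈va₀ S₂.y∈va₀ S₁.e∈c₀y S₂.e∈c₀y (∉⇒∦′ cl-flat c₀∉L S₁.e∈L) e₁∥e₂))
        where
        module S₁ = Step S₁
        module S₂ = Step S₂

      abstract
        -- Starts from the colour of `z` rather than that of `d`, so that it also applies to a `d`
        -- whose colour is still to be found, as in `reverse-colour`. Each later point lies on two
        -- lines whose only common colour is `a`.
        step-via : ∀ {d z} → d ∈ line u v → z ∈ line c₀ d → z ∈ line v z₀ → κ z ≡ c →
                   Σ[ e ∈ Fin n ] Step d e × κ e ≡ a
        step-via d∈L z∈c₀d z∈vz₀ κz
          with z∈K ← line-⊆ flat v∈K z₀∈K z∈vz₀
          with y , y∈uz , y∈va₀ ← meet u∈K z∈K v∈K a₀∈K (κ-∦ κu κz a≢c) (κ-∦ κv κa₀ b≢a)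
          with κy ← common-colour κz κu κv κa₀ c≢b c≢a b≢a (line-sym y∈uz) y∈va₀
          with e , e∈c₀y , e∈L ← meet c₀∈K (line-⊆ flat v∈K a₀∈K y∈va₀) u∈K v∈K (κ-∦ κc₀ κy c≢a) (κ-∦ κu κv a≢b)
          = e
          , record { d∈L = d∈L ; e∈L = e∈L ; z∈c₀d = z∈c₀d ; z∈vz₀ = z∈vz₀
                   ; y∈uz = y∈uz ; y∈va₀ = y∈va₀ ; e∈c₀y = e∈c₀y }
          , common-colour κc₀ κy κv κu c≢b c≢a b≢a e∈c₀y (line-sym e∈L)

      abstract
        step : ∀ {d} → d ∈ line u v → κ d ≡ a → Σ[ e ∈ Fin n ] Step d e × κ e ≡ a
        step d∈L κd
          with z , z∈c₀d , z∈vz₀ ← meet c₀∈K (line-⊆ flat u∈K v∈K d∈L) v∈K z₀∈K (κ-∦ κc₀ κd c≢a) (κ-∦ κv κz₀ b≢c)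
          = step-via d∈L z∈c₀d z∈vz₀ (common-colour κd κc₀ κv κz₀ a≢b a≢c b≢c (line-sym z∈c₀d) z∈vz₀)

      Coloured-a : Set
      Coloured-a = Σ[ d ∈ Fin n ] d ∈ line u v × κ d ≡ a

      next : Coloured-a → Coloured-a
      next (d , d∈L , κd) with e , S , κe ← step d∈L κd = e , Step.e∈L S , κe

      abstract
        next-injective : ∀ s t → proj₁ (next s) ∥ proj₁ (next t) → proj₁ s ∥ proj₁ t
        next-injective (_ , s∈L , κs) (_ , t∈L , κt) =
          step-injective (proj₁ (proj₂ (step s∈L κs))) (proj₁ (proj₂ (step t∈L κt)))

      -- By finiteness the image `e` of `d` is, up to `∥`, also the image of some `d′` of colour
      -- `a`; injectivity of the projectivity then gives `d′ ∥ d`.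
      reverse-colour : ∀ {d z} → d ∈ line u v → z ∈ line c₀ d → z ∈ line v z₀ → κ z ≡ c → κ d ≡ a
      reverse-colour d∈L z∈c₀d z∈vz₀ κz
        with e , S , κe ← step-via d∈L z∈c₀d z∈vz₀ κz
        with (_ , d′∈L , κd′) , e′∥e ← injective⇒surjective proj₁ next next-injective (e , Step.e∈L S , κe)
        = trans (sym (parallel-colour (step-injective (proj₁ (proj₂ (step d′∈L κd′))) S e′∥e))) κd′

    -- The point `z₃` is built to lie on `c₀ v′` and to have colour `c`. With `z₃` in place of `z₀`
    -- in the projectivity, `reverse-colour` gives `v′` the colour `a`, although its colour is `b`.
    no-mixed-line : ∀ {u w v v′ c₀ z₀ a₀} →
      u ∈ K → v ∈ K → c₀ ∈ K → z₀ ∈ K → a₀ ∈ K → w ∈ line u v → v′ ∈ line u v → ¬ u ∥ w → ¬ v ∥ v′ →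
      κ u ≡ a → κ w ≡ a → κ v ≡ b → κ v′ ≡ b → κ c₀ ≡ c → κ z₀ ≡ c → κ a₀ ≡ a →
      c₀ ∉ line v z₀ → a₀ ∉ line u v → ∅
    no-mixed-line {u} {w} {v} {v′} {c₀} {z₀} {a₀} u∈K v∈K c₀∈K z₀∈K a₀∈K w∈L v′∈L u∦w v∦v′
      κu κw κv κv′ κc₀ κz₀ κa₀ c₀∉ a₀∉
      with w∈K ← line-⊆ flat u∈K v∈K w∈L
      with v′∈K ← line-⊆ flat u∈K v∈K v′∈L
      -- Using `w` here keeps `z₃` away from `c₀`: with `u` in its place, `u z₂` would be the line
      -- `c₀ u`, which meets `c₀ v′` in `c₀`.
      with z₂ , z₂∈c₀w , z₂∈vz₀ ← meet c₀∈K w∈K v∈K z₀∈K (κ-∦ κc₀ κw c≢a) (κ-∦ κv κz₀ b≢c)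
      with κz₂ ← common-colour κw κc₀ κv κz₀ a≢b a≢c b≢c (line-sym z₂∈c₀w) z₂∈vz₀
      with z₂∈K ← line-⊆ flat v∈K z₀∈K z₂∈vz₀
      with z₃ , z₃∈c₀v′ , z₃∈uz₂ ← meet c₀∈K v′∈K u∈K z₂∈K (κ-∦ κc₀ κv′ c≢b) (κ-∦ κu κz₂ a≢c)
      with κz₃ ← common-colour κv′ κc₀ κu κz₂ b≢a b≢c a≢c (line-sym z₃∈c₀v′) z₃∈uz₂
      = b≢a (trans (sym κv′) (reverse-colour v′∈L z₃∈c₀v′ line-right κz₃))
      where
      c₀∉L : c₀ ∉ line u v
      c₀∉L = third-∉ κu κv κc₀ a≢b a≢c b≢c

      c₀∦z₃ : ¬ c₀ ∥ z₃
      c₀∦z₃ c₀∥z₃ = u∦w (meet-unique cl-flat c₀∉L line-left w∈L line-right w∈c₀u)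
        where
        z₂∈c₀u : z₂ ∈ line c₀ u
        z₂∈c₀u = line-sym (line-exchange (flat-∥ cl-flat (∥-sym c₀∥z₃) z₃∈uz₂) (κ-∦ κu κc₀ a≢c))
        w∈c₀u : w ∈ line c₀ u
        w∈c₀u = line-⊆-flat cl-flat line-left z₂∈c₀u z₂∈c₀w (∉⇒∦′ cl-flat c₀∉ z₂∈vz₀)

      c₀∉vz₃ : c₀ ∉ line v z₃
      c₀∉vz₃ c₀∈ = third-∉ κu κv κz₃ a≢b a≢c b≢c
        (line-⊆-flat cl-flat line-right v′∈L (line-⊆-flat cl-flat c₀∈ line-right z₃∈c₀v′ c₀∦z₃) v∦v′)

      open Projectivity u∈K v∈K c₀∈K (line-⊆ flat u∈K z₂∈K z₃∈uz₂) a₀∈K κu κv κc₀ κz₃ κa₀ c₀∉vz₃ a₀∉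

    -- Projecting `c₁` and `c₂` from `b′` to the line `xᵃ xᵇ` gives two non-parallel points `v`,
    -- `v′` of colour `b`. A second point `w` of colour `a` would complete the configuration that
    -- `no-mixed-line` excludes.
    unique-on-line : ∀ {xᵃ xᵇ c₁ c₂ u w b′} →
      xᵃ ∈ K → xᵇ ∈ K → c₁ ∈ K → c₂ ∈ K → b′ ∈ K → u ∈ line xᵃ xᵇ → w ∈ line xᵃ xᵇ → u ∈ line c₁ c₂ →
      κ xᵃ ≡ a → κ xᵇ ≡ b → κ c₁ ≡ c → κ c₂ ≡ c → κ u ≡ a → κ w ≡ a → κ b′ ≡ b →
      b′ ∉ line xᵃ xᵇ → u ∥ w
    unique-on-line {xᵃ} {xᵇ} {c₁} {c₂} {u} {w} {b′} xᵃ∈K xᵇ∈K c₁∈K c₂∈K b′∈K u∈L w∈L u∈c₁c₂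
      κxᵃ κxᵇ κc₁ κc₂ κu κw κb′ b′∉L = decidable-stable (u ∥? w) mixed
      where
      u∈K = line-⊆ flat xᵃ∈K xᵇ∈K u∈L
      w∈K = line-⊆ flat xᵃ∈K xᵇ∈K w∈L

      c₁∉L : c₁ ∉ line xᵃ xᵇ
      c₁∉L = third-∉ κxᵃ κxᵇ κc₁ a≢b a≢c b≢c

      mixed : ¬ u ∥ w → ∅
      mixed u∦w
        with v , v∈c₁b′ , v∈L ← meet c₁∈K b′∈K xᵃ∈K xᵇ∈K (κ-∦ κc₁ κb′ c≢b) (κ-∦ κxᵃ κxᵇ a≢b)
        with v′ , v′∈c₂b′ , v′∈L ← meet c₂∈K b′∈K xᵃ∈K xᵇ∈K (κ-∦ κc₂ κb′ c≢b) (κ-∦ κxᵃ κxᵇ a≢b)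
        with a₀ , a₀∈c₁w , a₀∈b′u ← meet c₁∈K w∈K b′∈K u∈K (κ-∦ κc₁ κw c≢a) (κ-∦ κb′ κu b≢a)
        with κv ← common-colour κc₁ κb′ κxᵃ κxᵇ c≢a c≢b a≢b v∈c₁b′ v∈L
        with κv′ ← common-colour κc₂ κb′ κxᵃ κxᵇ c≢a c≢b a≢b v′∈c₂b′ v′∈L
        with κa₀ ← common-colour κc₁ κw κb′ κu c≢b c≢a b≢a a₀∈c₁w a₀∈b′u
        with L⊆uv ← line-span u∈L v∈L (κ-∦ κu κv a≢b)
        = no-mixed-line u∈K (line-⊆ flat xᵃ∈K xᵇ∈K v∈L) c₁∈K c₂∈K (line-⊆ flat b′∈K u∈K a₀∈b′u)
            (L⊆uv w∈L) (L⊆uv v′∈L) u∦w v∦v′ κu κw κv κv′ κc₁ κc₂ κa₀ c₁∉vc₂ (a₀∉L ∘ line-⊆ cl-flat u∈L v∈L)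
        where
        v∦v′ : ¬ v ∥ v′
        v∦v′ v∥v′ = third-∉ κc₁ κb′ κu c≢b c≢a b≢a
          (line-⊆ cl-flat line-left
             (line-⊆-flat cl-flat line-right (flat-∥ cl-flat v∥v′ v∈c₁b′) (line-sym v′∈c₂b′)
                (∉⇒∦′ cl-flat b′∉L v′∈L))
             u∈c₁c₂)
        a₀∉L : a₀ ∉ line xᵃ xᵇ
        a₀∉L a₀∈L = u∦w (∥-trans (meet-unique cl-flat b′∉L u∈L a₀∈L line-right a₀∈b′u)
                                  (meet-unique cl-flat c₁∉L a₀∈L w∈L a₀∈c₁w line-right))
        c₁∉vc₂ : c₁ ∉ line v c₂
        c₁∉vc₂ c₁∈ = third-∉ κv κc₂ κu b≢c b≢a c≢a (line-⊆ cl-flat c₁∈ line-right u∈c₁c₂)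

-- Colour classes confined to proper flats

module Confinement {n m : ℕ} {Γ : ProjectiveGeometry n} {κ : Fin n → Fin m} (rf : RainbowFree Γ κ) where
  open Coloured rf public

  record Confined (K : Subset n) (i : Fin m) : Set where
    field
      set       : Subset n
      flat      : Flat set
      below     : set ⊆ K
      missing   : Fin n
      missing∈K : missing ∈ K
      missing∉  : missing ∉ set
      contains  : ∀ {x} → x ∈ K → κ x ≡ i → x ∈ set

  SomeConfined : Subset n → Set
  SomeConfined K = Σ[ i ∈ Fin m ] Confined K i

  confined-∉ : ∀ {K F y i} → Flat F → F ⊆ K → y ∈ K → y ∉ F →
               (∀ {x} → x ∈ K → κ x ≡ i → x ∈ F) → SomeConfined K
  confined-∉ {F = F} {y} fF F⊆K y∈K y∉F all = _ , record
    { set = F ; flat = fF ; below = F⊆K ; missing = y ; missing∈K = y∈K ; missing∉ = y∉F ; contains = all }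

  -- Class `c` lies on the line `xᶜ c₂`. For any other point `z` of that class, the line `xᶜ z`
  -- meets `xᵃ xᵇ` in some `u₃`; if `u₃` has colour `a`, it is parallel to `u` by `unique-on-line`,
  -- so `z` lies on `xᶜ c₂`.
  confined-off-line : ∀ {K a b c xᵃ xᵇ xᶜ c₂ u a′ b′} → Plane K → a ≢ b → a ≢ c → b ≢ c →
    xᵃ ∈ K → xᵇ ∈ K → xᶜ ∈ K → c₂ ∈ K → a′ ∈ K → b′ ∈ K →
    κ xᵃ ≡ a → κ xᵇ ≡ b → κ xᶜ ≡ c → κ c₂ ≡ c → κ a′ ≡ a → κ b′ ≡ b → κ u ≡ a →
    u ∈ line xᶜ c₂ → u ∈ line xᵃ xᵇ → a′ ∉ line xᵃ xᵇ → b′ ∉ line xᵃ xᵇ → SomeConfined K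
  confined-off-line {K} {a} {b} {c} {xᵃ} {xᵇ} {xᶜ} {c₂} {u} {a′} {b′} plane a≢b a≢c b≢c
    xᵃ∈K xᵇ∈K xᶜ∈K c₂∈K a′∈K b′∈K κxᵃ κxᵇ κxᶜ κc₂ κa′ κb′ κu u∈cc₂ u∈L a′∉L b′∉L =
    confined-∉ cl-flat (line-⊆ flat xᶜ∈K c₂∈K) xᵇ∈K xᵇ∉ all
    where
    open Plane plane

    xᵇ∉ : xᵇ ∉ line xᶜ c₂
    xᵇ∉ = third-∉ κxᶜ κu κxᵇ (≢-sym a≢c) (≢-sym b≢c) a≢b ∘ line-span line-left u∈cc₂ (κ-∦ κxᶜ κu (≢-sym a≢c))

    u∥ : ∀ {w} → w ∈ line xᵃ xᵇ → κ w ≡ a → u ∥ w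
    u∥ w∈L κw = PlaneColours.unique-on-line plane a≢b a≢c b≢c
      xᵃ∈K xᵇ∈K xᶜ∈K c₂∈K b′∈K u∈L w∈L u∈cc₂ κxᵃ κxᵇ κxᶜ κc₂ κu κw κb′ b′∉L

    all : ∀ {z} → z ∈ K → κ z ≡ c → z ∈ line xᶜ c₂
    all {z} z∈K κz with xᶜ ∥? z
    ... | yes xᶜ∥z = ∥⇒∈line xᶜ∥z
    ... | no xᶜ∦z with u₃ , u₃∈cz , u₃∈L ← meet xᶜ∈K z∈K xᵃ∈K xᵇ∈K xᶜ∦z (κ-∦ κxᵃ κxᵇ a≢b)
                  with two-coloured κxᵃ κxᵇ a≢b u₃∈L
    ... | inj₁ κu₃ = line-⊆-flat cl-flat line-left (flat-∥ cl-flat (u∥ u₃∈L κu₃) u∈cc₂) u₃∈cz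
                       (κ-∦ κxᶜ κu₃ (≢-sym a≢c))
    -- Now `u` is the only point of colour `a` on `xᵃ xᵇ` and `u₃` the only one of colour `b`, up to
    -- `∥`, which leaves no colour for a third point.
    ... | inj₂ κu₃ with t , t∈L , xᵃ∦t , xᵇ∦t ← third (κ-∦ κxᵃ κxᵇ a≢b)
                   with two-coloured κxᵃ κxᵇ a≢b t∈L
    ...   | inj₁ κt = absurd (xᵃ∦t (∥-trans (∥-sym (u∥ line-left κxᵃ)) (u∥ t∈L κt)))
    ...   | inj₂ κt = absurd (xᵇ∦t (∥-trans (∥-sym (u₃∥ line-right κxᵇ)) (u₃∥ t∈L κt)))
      where
      u₃∥ : ∀ {w} → w ∈ line xᵃ xᵇ → κ w ≡ b → u₃ ∥ w
      u₃∥ w∈L κw = PlaneColours.unique-on-line plane (≢-sym a≢b) b≢c a≢c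
        xᵇ∈K xᵃ∈K xᶜ∈K z∈K a′∈K (line-sym u₃∈L) (line-sym w∈L) u₃∈cz κxᵇ κxᵃ κxᶜ κz κu₃ κw κa′ (a′∉L ∘ line-sym)

  -- If class `a` or class `b` lies on the line `xᵃ xᵇ`, or class `c` is a single point, that flat
  -- is proper. Otherwise `confined-off-line` applies, with `a` and `b` exchanged when `u` has
  -- colour `b`.
  confined-plane : ∀ {K a b c xᵃ xᵇ xᶜ} → Plane K → a ≢ b → a ≢ c → b ≢ c →
    xᵃ ∈ K → xᵇ ∈ K → xᶜ ∈ K → κ xᵃ ≡ a → κ xᵇ ≡ b → κ xᶜ ≡ c → SomeConfined K
  confined-plane {K} {a} {b} {c} {xᵃ} {xᵇ} {xᶜ} plane a≢b a≢c b≢c xᵃ∈K xᵇ∈K xᶜ∈K κxᵃ κxᵇ κxᶜ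
    with any? (λ x → (x ∈? K) ×-dec (κ x ≟ a) ×-dec ¬? (x ∈? line xᵃ xᵇ))
       | any? (λ x → (x ∈? K) ×-dec (κ x ≟ b) ×-dec ¬? (x ∈? line xᵃ xᵇ))
       | any? (λ x → (x ∈? K) ×-dec (κ x ≟ c) ×-dec ¬? (xᶜ ∥? x))
  ... | no ¬a′ | _ | _ =
        confined-∉ cl-flat (line-⊆ (Plane.flat plane) xᵃ∈K xᵇ∈K) xᶜ∈K (third-∉ κxᵃ κxᵇ κxᶜ a≢b a≢c b≢c)
          λ {x} x∈K κx → decidable-stable (x ∈? _) λ x∉ → ¬a′ (x , x∈K , κx , x∉)
  ... | yes _ | no ¬b′ | _ =
        confined-∉ cl-flat (line-⊆ (Plane.flat plane) xᵃ∈K xᵇ∈K) xᶜ∈K (third-∉ κxᵃ κxᵇ κxᶜ a≢b a≢c b≢c)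
          λ {x} x∈K κx → decidable-stable (x ∈? _) λ x∉ → ¬b′ (x , x∈K , κx , x∉)
  ... | yes _ | yes _ | no ¬c₂ =
        confined-∉ cl-flat (cl-min (Plane.flat plane) (⁅⁆⊆ xᶜ∈K)) xᵃ∈K (κ-∦ κxᶜ κxᵃ (≢-sym a≢c))
          λ {x} x∈K κx → decidable-stable (x ∈? _) λ x∉ → ¬c₂ (x , x∈K , κx , x∉)
  ... | yes (a′ , a′∈K , κa′ , a′∉L) | yes (b′ , b′∈K , κb′ , b′∉L) | yes (c₂ , c₂∈K , κc₂ , xᶜ∦c₂)
    with u , u∈cc₂ , u∈L ← Plane.meet plane xᶜ∈K c₂∈K xᵃ∈K xᵇ∈K xᶜ∦c₂ (κ-∦ κxᵃ κxᵇ a≢b)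
    with two-coloured κxᵃ κxᵇ a≢b u∈L
  ... | inj₁ κu = confined-off-line plane a≢b a≢c b≢c xᵃ∈K xᵇ∈K xᶜ∈K c₂∈K a′∈K b′∈K
                    κxᵃ κxᵇ κxᶜ κc₂ κa′ κb′ κu u∈cc₂ u∈L a′∉L b′∉L
  ... | inj₂ κu = confined-off-line plane (≢-sym a≢b) b≢c a≢c xᵇ∈K xᵃ∈K xᶜ∈K c₂∈K b′∈K a′∈K
                    κxᵇ κxᵃ κxᶜ κc₂ κb′ κa′ κu u∈cc₂ (line-sym u∈L) (b′∉L ∘ line-sym) (a′∉L ∘ line-sym)

  CosetColours : Subset n → Subset n → Set
  CosetColours K G = ∀ {z z′} → z ∈ K → z ∉ G → z′ ∉ G → z′ ∈ G ⊕ z → κ z′ ≡ κ z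

  -- A line through a point of `X` carries `c` and at most one further colour. Hence two of its
  -- points off `cl X` can differ in colour only if one has colour `c`, which `pure` excludes.
  -- `absorbs-cl` carries this from `X` to `cl X`.
  coset-colours : ∀ {K X c o} → Flat K → X ⊆ K → o ∈ cl X → (∀ {y} → y ∈ X → κ y ≡ c) →
    (∀ {z z′} → z ∈ K → z ∉ cl X → z′ ∉ cl X → z′ ∈ cl X ⊕ z → κ z ≡ c → κ z′ ≡ c) →
    CosetColours K (cl X)
  coset-colours {K} {X} {c} fK X⊆K o∈ κX pure {z} {z′} z∈K z∉ z′∉ z′∈
    with g , g∈ , z′∈gz ← join-point cl-flat o∈ z′∈
    = proj₂ (proj₂ (Absorbs.coset (absorbs-cl S-∥ base g∈) (z∈K , z∉ , refl) z′∈gz (∉⇒∦ cl-flat g∈ z′∉)))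
    where
    S : Fin n → Set
    S w = w ∈ K × w ∉ cl X × κ w ≡ κ z

    S-∥ : ∀ {x y} → x ∥ y → S x → S y
    S-∥ x∥y (x∈K , x∉ , κx) =
      flat-∥ fK x∥y x∈K , x∉ ∘ flat-∥ cl-flat (∥-sym x∥y) , trans (sym (parallel-colour x∥y)) κx

    same : ∀ {y w w′} → κ y ≡ c → w ∈ K → w′ ∈ K → w ∉ cl X → w′ ∉ cl X → y ∈ cl X →
           w′ ∈ line y w → ¬ y ∥ w′ → κ w′ ≡ κ w
    same {y} {w} {w′} κy w∈K w′∈K w∉ w′∉ y∈ w′∈ y∦w′ with κ w ≟ c | κ w′ ≟ c
    ... | yes κw | _ = trans (pure w∈K w∉ w′∉ (line-⊆ cl-flat (⊕-base y∈) ⊕-point w′∈) κw) (sym κw)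
    ... | no κw≢c | yes κw′ = absurd (κw≢c
            (pure w′∈K w′∉ w∉ (line-⊆ cl-flat (⊕-base y∈) ⊕-point (line-exchange w′∈ y∦w′)) κw′))
    ... | no κw≢c | no κw′≢c with line-colour (λ κy≡κw → κw≢c (trans (sym κy≡κw) κy)) w′∈
    ...   | inj₁ κw′≡κy = absurd (κw′≢c (trans κw′≡κy κy))
    ...   | inj₂ κw′≡κw = κw′≡κw

    base : ∀ {y} → y ∈ X → Absorbs S y
    base y∈X = absorbs (λ (_ , y∉ , _) → y∉ (cl-ext y∈X))
      λ (w∈K , w∉ , κw) w′∈ y∦w′ →
        let w′∈K = line-⊆ fK (X⊆K y∈X) w∈K w′∈
            w′∉  = λ w′∈G → w∉ (line-⊆-flat cl-flat (cl-ext y∈X) w′∈G w′∈ y∦w′)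
        in w′∈K , w′∉ , trans (same (κX y∈X) w∈K w′∈K w∉ w′∉ (cl-ext y∈X) w′∈ y∦w′) κw

  -- When colours are constant on the cosets of G, a complement of G in K is a coloured
  -- copy of the quotient K / G, so its flats can be lifted to K.
  module Lift {K G : Subset n} {o : Fin n} (fK : Flat K) (fG : Flat G) (G⊆K : G ⊆ K) (o∈G : o ∈ G)
              (cosets : CosetColours K G) (N : Complement ⊥ G K) where
    private module N = Complement N

    lift-⊆ : ∀ {F} → F ⊆ N.set → cl (F ∪ G) ⊆ K
    lift-⊆ F⊆N = cl-min fK (∪-⊆ (N.below ∘ F⊆N) G⊆K)

    -- If `y` were on a line `f g` with `f` in `F` and `g` in `G`, then `g` would lie in the
    -- complement, which is disjoint from `G`.
    lift-∉ : ∀ {F y} → Flat F → F ⊆ N.set → y ∈ N.set → y ∉ F → y ∉ cl (F ∪ G)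
    lift-∉ {F} {y} fF F⊆N y∈N y∉F y∈ with nonempty? F
    ... | no empty = ∉⊥ (N.meet y∈N (cl-min fG (∪-⊆ (λ x∈F → absurd (empty (_ , x∈F))) (λ x∈G → x∈G)) y∈))
    ... | yes (f₀ , f₀∈F) with f , g , f∈F , g∈G , y∈fg ← join fF fG f₀∈F o∈G y∈
        = ∉⊥ (N.meet (line-⊆-flat N.flat (F⊆N f∈F) y∈N y∈fg (∉⇒∦ fF f∈F y∉F)) g∈G)

    -- The point `k` is the projection of `z` from `G` to the complement. It lies in the coset of
    -- `z` and so has its colour.
    lift-colour : ∀ {F y z} → y ∈ N.set → z ∈ K → z ∉ cl (F ∪ G) →
                  Σ[ k ∈ Fin n ] k ∈ N.set × k ∉ F × κ k ≡ κ z
    lift-colour {F} {y} {z} y∈N z∈K z∉ with k , g , k∈N , g∈G , z∈kg ← join N.flat fG y∈N o∈G (N.spans z∈K)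
      = k , k∈N , k∉F , sym (cosets (N.below k∈N) (∉⊥ ∘ N.meet k∈N) (z∉ ∘ cl-ext ∘ q⊆p∪q F G)
          (line-⊆ cl-flat ⊕-point (⊕-base g∈G) z∈kg))
      where
      k∉F : k ∉ F
      k∉F k∈F = z∉ (line-⊆ cl-flat (cl-ext (p⊆p∪q G k∈F)) (cl-ext (q⊆p∪q F G g∈G)) z∈kg)

-- Colours on the two sides of a hyperplane

module HyperplaneStep {n m : ℕ} {Γ : ProjectiveGeometry n} {κ : Fin n → Fin m} (rf : RainbowFree Γ κ) where
  open Confinement rf public

  class? : ∀ K c x → Dec (x ∈ K × κ x ≡ c)
  class? K c x = (x ∈? K) ×-dec (κ x ≟ c)

  class : Subset n → Fin m → Subset n
  class K c = sieve (class? K c)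

  ∈-class⁺ : ∀ {K c x} → x ∈ K → κ x ≡ c → x ∈ class K c
  ∈-class⁺ {K} {c} x∈K κx = ∈-sieve⁺ (class? K c) (x∈K , κx)

  class-⊆ : ∀ {K c} → class K c ⊆ K
  class-⊆ {K} {c} = proj₁ ∘ ∈-sieve⁻ (class? K c)

  class-colour : ∀ {K c x} → x ∈ class K c → κ x ≡ c
  class-colour {K} {c} = proj₂ ∘ ∈-sieve⁻ (class? K c)

  -- Off the closure no point of `K` has colour `c`, so the purity condition of `coset-colours`
  -- holds vacuously.
  cl-class-cosets : ∀ {K c o} → Flat K → o ∈ K → κ o ≡ c → CosetColours K (cl (class K c))
  cl-class-cosets fK o∈K κo = coset-colours fK class-⊆ (cl-ext (∈-class⁺ o∈K κo)) class-colour
    λ z∈K z∉ _ _ κz → absurd (z∉ (cl-ext (∈-class⁺ z∈K κz)))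

  module AcrossHyperplane {K H : Subset n} {c : Fin m} {o : Fin n}
    (fK : Flat K) (hyp : Hyperplane K H) (o∈H : o ∈ H) (κo : κ o ≡ c) where

    open Hyperplane hyp renaming (flat to fH; below to H⊆K)

    G : Subset n
    G = cl (class H c)

    c∈G : ∀ {x} → x ∈ H → κ x ≡ c → x ∈ G
    c∈G x∈H κx = cl-ext (∈-class⁺ x∈H κx)

    o∈G : o ∈ G
    o∈G = c∈G o∈H κo

    G⊆H : G ⊆ H
    G⊆H = cl-min fH class-⊆

    H-cosets : CosetColours H G
    H-cosets = cl-class-cosets fH o∈H κo

    -- The modular law for `G ⊕ h` inside `H`: `w` lies on a line from a point `g` of `G ⊕ h` to
    -- `x`, and if `w` were not parallel to `g`, then `x` would lie in `H`.
    modular : ∀ {x h w} → x ∉ H → h ∈ H → w ∈ H → w ∈ G ⊕ x ⊕ h → w ∈ G ⊕ h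
    modular {x} {h} {w} x∉H h∈H w∈H w∈
      with g , g∈ , w∈gx ← join-point (cl-flat {G ∪ ⁅ h ⁆}) (⊕-base o∈G)
             (⊕-⊆ cl-flat (⊕-⊆ cl-flat (⊕-base ∘ ⊕-base) ⊕-point) (⊕-base ⊕-point) w∈)
      with g ∥? w
    ... | yes g∥w = flat-∥ cl-flat g∥w g∈
    ... | no g∦w  = absurd (x∉H (line-⊆-flat fH (⊕-⊆ fH G⊆H h∈H g∈) w∈H w∈gx g∦w))

    ⊕∩H : ∀ {x w} → x ∉ H → w ∈ H → w ∈ G ⊕ x → w ∈ G
    ⊕∩H x∉H w∈H w∈ = ⊕-⊆ cl-flat (λ g∈ → g∈) o∈G (modular x∉H o∈H w∈H (⊕-base w∈))

    -- For `x` off `H`, `h` is the projection of `z` from `x` to `H`.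
    Direction : Fin n → Fin n → Fin n → Set
    Direction x z h = h ∈ line x z × h ∈ H

    direction : ∀ {x z} → x ∈ K → z ∈ K → z ∉ G ⊕ x → Σ[ h ∈ Fin n ] Direction x z h
    direction x∈K z∈K z∉ = meets-hyperplane hyp o∈H x∈K z∈K (∉⇒∦ cl-flat ⊕-point z∉)

    direction-∉G : ∀ {x z h} → x ∉ H → z ∉ G ⊕ x → Direction x z h → h ∉ G
    direction-∉G x∉H z∉ (h∈xz , h∈H) h∈G =
      z∉ (line-⊆-flat cl-flat ⊕-point (⊕-base h∈G) h∈xz (∉⇒∦′ fH x∉H h∈H))

    -- A point of colour `i` outside `G ⊕ x` has a direction outside `G`, of colour `c` or `i`. The
    -- first would put it in `G`, and `avoid` excludes the second. So class `i` lies in `G ⊕ x`,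
    -- which misses `h₀`.
    confined-beside : ∀ {x i h₀} → x ∈ K → x ∉ H → κ x ≡ c → i ≢ c → h₀ ∈ H → h₀ ∉ G →
      (∀ {h} → h ∈ H → h ∉ G → κ h ≢ i) → SomeConfined K
    confined-beside {x} {i} x∈K x∉H κx i≢c h₀∈H h₀∉G avoid =
      confined-∉ cl-flat (⊕-⊆ fK (H⊆K ∘ G⊆H) x∈K) (H⊆K h₀∈H) (h₀∉G ∘ ⊕∩H x∉H h₀∈H)
        λ {z} z∈K κz → decidable-stable (z ∈? G ⊕ x) (outside-absurd z∈K κz)
      where
      outside-absurd : ∀ {z} → z ∈ K → κ z ≡ i → ¬ z ∉ G ⊕ x
      outside-absurd z∈K κz z∉
        with h , dir@(h∈xz , h∈H) ← direction x∈K z∈K z∉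
        with two-coloured κx κz (≢-sym i≢c) h∈xz
      ... | inj₁ κh = direction-∉G x∉H z∉ dir (c∈G h∈H κh)
      ... | inj₂ κh = avoid h∈H (direction-∉G x∉H z∉ dir) κh

    -- Here a coset of `G` has points off `H` of both colours `c` and `a`. Then the points of colour
    -- `b` outside `Q` are closed under cosets of every point of class `c`, so the span of that
    -- class avoids them and is proper.
    module MixedCoset {a b : Fin m} {x p : Fin n} (a≢b : a ≢ b) (a≢c : a ≢ c) (b≢c : b ≢ c)
      (exhaust : ∀ i → i ≡ a ⊎ i ≡ b ⊎ i ≡ c)
      (x∈K : x ∈ K) (x∉H : x ∉ H) (κx : κ x ≡ c) (p∈ : p ∈ G ⊕ x) (p∉H : p ∉ H) (κp : κ p ≡ a) where

      Q : Subset n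
      Q = G ⊕ x

      Q⊆K : Q ⊆ K
      Q⊆K = ⊕-⊆ fK (H⊆K ∘ G⊆H) x∈K

      -- Within a coset of `Q` the directions lie in a single coset of `G` in `H`, by the modular
      -- law.
      same-direction : ∀ {z h h′} → z ∉ Q → Direction x z h → h′ ∈ H → h′ ∉ G → h′ ∈ Q ⊕ z → κ h′ ≡ κ h
      same-direction z∉ dir@(h∈xz , h∈H) h′∈H h′∉G h′∈ =
        H-cosets h∈H (direction-∉G x∉H z∉ dir) h′∉G (modular x∉H h∈H h′∈H
          (⊕-⊆ cl-flat ⊕-base (line-⊆-flat cl-flat (⊕-base ⊕-point) ⊕-point h∈xz (∉⇒∦′ fH x∉H h∈H)) h′∈))

      -- Colour `c` would put the direction into `G`. If it had colour `b`, the projection of `z`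
      -- from `p` would have colour `b` too, on a line with colours `a` and `c`.
      c-direction : ∀ {z h} → z ∈ K → z ∉ Q → κ z ≡ c → Direction x z h → κ h ≡ a
      c-direction {z} {h} z∈K z∉ κz dir@(h∈xz , h∈H) with exhaust (κ h)
      ... | inj₁ κh = κh
      ... | inj₂ (inj₂ κh) = absurd (direction-∉G x∉H z∉ dir (c∈G h∈H κh))
      ... | inj₂ (inj₁ κh)
            with h′ , h′∈pz , h′∈H ← meets-hyperplane hyp o∈H (Q⊆K p∈) z∈K (∉⇒∦ cl-flat p∈ z∉)
            = absurd (third-∉ κp κz (trans (same-direction z∉ dir h′∈H h′∉G h′∈) κh) a≢c a≢b (≢-sym b≢c) h′∈pz)
        where
        h′∉G : h′ ∉ G
        h′∉G h′∈G = z∉ (line-⊆-flat cl-flat p∈ (⊕-base h′∈G) h′∈pz (∉⇒∦′ fH p∉H h′∈H))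
        h′∈ : h′ ∈ Q ⊕ z
        h′∈ = line-⊆ cl-flat (⊕-base p∈) ⊕-point h′∈pz

      b-direction : ∀ {z h} → z ∉ Q → κ z ≡ b → Direction x z h → κ h ≡ b
      b-direction z∉ κz dir@(h∈xz , h∈H) with two-coloured κx κz (≢-sym b≢c) h∈xz
      ... | inj₁ κh = absurd (direction-∉G x∉H z∉ dir (c∈G h∈H κh))
      ... | inj₂ κh = κh

      -- The directions of `z` and `z′` lie in one coset of `G`, yet have the colours `b` and `a`.
      clash : ∀ {z z′} → z ∈ K → z ∉ Q → z′ ∈ K → z′ ∉ Q → κ z ≡ b → κ z′ ≡ c → z ∈ Q ⊕ z′ → ∅
      clash z∈K z∉ z′∈K z′∉ κz κz′ z∈
        with h , dir@(h∈xz , h∈H) ← direction x∈K z∈K z∉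
        with h′ , dir′ ← direction x∈K z′∈K z′∉
        = a≢b (trans (sym (c-direction z′∈K z′∉ κz′ dir′))
            (trans (sym (same-direction z′∉ dir′ h∈H (direction-∉G x∉H z∉ dir)
                           (line-⊆ cl-flat (⊕-base ⊕-point) z∈ h∈xz)))
              (b-direction z∉ κz dir)))

      b-outside : Fin n → Set
      b-outside z = z ∈ K × z ∉ Q × κ z ≡ b

      -- Otherwise the direction u of z′ has colour a and lies on a line joining y to a point r of
      -- colour b on the line x z: a rainbow triangle.
      no-c-on-coset : ∀ {y z z′} → y ∈ K → y ∉ Q → κ y ≡ c → z ∈ K → z ∉ Q → κ z ≡ b →
        z′ ∈ K → z′ ∉ Q → κ z′ ≡ c → z′ ∈ line y z → ¬ y ∥ z′ → ∅
      no-c-on-coset {y} {z} {z′} y∈K y∉ κy z∈K z∉ κz z′∈K z′∉ κz′ z′∈yz y∦z′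
        with h , dir@(h∈xz , h∈H) ← direction x∈K z∈K z∉
        with u , dir′@(u∈xz′ , u∈H) ← direction x∈K z′∈K z′∉
        with κh ← b-direction z∉ κz dir
        with κu ← c-direction z′∈K z′∉ κz′ dir′
        with z∈xh ← line-exchange h∈xz (∉⇒∦′ fH x∉H h∈H)
        with r , r∈xh , u∈ry ← join-point (cl-flat {⁅ x ⁆ ∪ ⁅ h ⁆}) line-left
               (line-⊆ cl-flat (⊕-base line-left) (line-⊆ cl-flat ⊕-point (⊕-base z∈xh) z′∈yz) u∈xz′)
        = by-colour (two-coloured κx κh (≢-sym b≢c) r∈xh)
        where
        r∉ : r ∉ Q
        r∉ r∈Q with x ∥? r
        ... | no x∦r = direction-∉G x∉H z∉ dir (⊕∩H x∉H h∈H (line-⊆-flat cl-flat ⊕-point r∈Q r∈xh x∦r))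
        ... | yes x∥r = clash z∈K z∉ y∈K y∉ κz κy (line-⊆-flat cl-flat ⊕-point
                (line-⊆-flat cl-flat (⊕-base ⊕-point)
                   (line-⊆ cl-flat (⊕-base (flat-∥ cl-flat x∥r ⊕-point)) ⊕-point u∈ry)
                   u∈xz′ (∉⇒∦′ fH x∉H u∈H))
                z′∈yz y∦z′)
        by-colour : κ r ≡ c ⊎ κ r ≡ b → ∅
        by-colour (inj₂ κr) = third-∉ κr κy κu b≢c (≢-sym a≢b) (≢-sym a≢c) u∈ry
        -- `r` lies on the line `x h`, so its direction is again `h`, which would have both colours
        -- `a` and `b`.
        by-colour (inj₁ κr) = a≢b (trans (sym (c-direction
          (line-⊆ fK x∈K (H⊆K h∈H) r∈xh) r∉ κr (line-exchange r∈xh (∉⇒∦ cl-flat ⊕-point r∉) , h∈H))) κh)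

      absorbs-b-outside : ∀ {y} → y ∈ K → κ y ≡ c → Absorbs b-outside y
      absorbs-b-outside {y} y∈K κy = absorbs (λ (_ , _ , κy′) → b≢c (trans (sym κy′) κy)) coset
        where
        coset : ∀ {z z′} → b-outside z → z′ ∈ line y z → ¬ y ∥ z′ → b-outside z′
        coset {z} {z′} (z∈K , z∉ , κz) z′∈yz y∦z′ = z′∈K , z′∉ , κz′
          where
          z′∈K : z′ ∈ K
          z′∈K = line-⊆ fK y∈K z∈K z′∈yz
          z∈yz′ : z ∈ line y z′
          z∈yz′ = line-exchange z′∈yz y∦z′
          z′∉ : z′ ∉ Q
          z′∉ z′∈Q with y ∈? Q
          ... | yes y∈Q = z∉ (line-⊆ cl-flat y∈Q z′∈Q z∈yz′)
          ... | no y∉Q = clash z∈K z∉ y∈K y∉Q κz κy (line-⊆ cl-flat ⊕-point (⊕-base z′∈Q) z∈yz′)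
          κz′ : κ z′ ≡ b
          κz′ with two-coloured κy κz (≢-sym b≢c) z′∈yz | y ∈? Q
          ... | inj₂ eq | _ = eq
          ... | inj₁ eq | yes y∈Q = absurd (clash z∈K z∉ z′∈K z′∉ κz eq (line-⊆ cl-flat (⊕-base y∈Q) ⊕-point z∈yz′))
          ... | inj₁ eq | no y∉Q = absurd (no-c-on-coset y∈K y∉Q κy z∈K z∉ κz z′∈K z′∉ eq z′∈yz y∦z′)

      confined-c : ∀ {b₁} → b₁ ∈ H → b₁ ∉ G → κ b₁ ≡ b → SomeConfined K
      confined-c {b₁} b₁∈H b₁∉G κb₁ = confined-∉ cl-flat (cl-min fK class-⊆) (H⊆K b₁∈H) b₁∉ 
        λ x∈K κx → cl-ext (∈-class⁺ x∈K κx)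
        where
        b-outside-∥ : ∀ {y z} → y ∥ z → b-outside y → b-outside z
        b-outside-∥ y∥z (y∈K , y∉ , κy) =
          flat-∥ fK y∥z y∈K , y∉ ∘ flat-∥ cl-flat (∥-sym y∥z) , trans (sym (parallel-colour y∥z)) κy
        b₁∉ : b₁ ∉ cl (class K c)
        b₁∉ b₁∈ = Absorbs.disjoint
          (absorbs-cl b-outside-∥ (λ y∈ → absorbs-b-outside (class-⊆ y∈) (class-colour y∈)) b₁∈)
          (H⊆K b₁∈H , b₁∉G ∘ ⊕∩H x∉H b₁∈H , κb₁)

    K-cosets : (∀ {x p} → x ∈ K → x ∉ H → κ x ≡ c → p ∈ G ⊕ x → p ∉ H → κ p ≡ c) → CosetColours K G
    K-cosets pure = coset-colours fK (H⊆K ∘ class-⊆) o∈G class-colour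
      λ {z} {z′} z∈K z∉ z′∉ z′∈ κz →
        let z∉H = λ z∈H → z∉ (c∈G z∈H κz)
        in pure z∈K z∉H κz z′∈ (λ z′∈H → z′∉ (⊕∩H z∉H z′∈H z′∈))

-- Induction for three colours

module Gallai {n m : ℕ} {Γ : ProjectiveGeometry n} {κ : Fin n → Fin m} (rf : RainbowFree Γ κ) where
  open HyperplaneStep rf public

  complement-smaller : ∀ {K G o} → (N : Complement ⊥ G K) → o ∈ G → o ∈ K → ∣ Complement.set N ∣ < ∣ K ∣
  complement-smaller N o∈G o∈K = p⊂q⇒∣p∣<∣q∣ (below , _ , o∈K , λ o∈ → ∉⊥ (meet o∈ o∈G))
    where open Complement N

  complement-nonempty : ∀ {K G h} → Flat G → (N : Complement ⊥ G K) → h ∈ K → h ∉ G → Nonempty (Complement.set N)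
  complement-nonempty fG N h∈K h∉G with nonempty? (Complement.set N)
  ... | yes ne = ne
  ... | no empty = absurd (h∉G (cl-min fG (∪-⊆ (λ x∈ → absurd (empty (_ , x∈))) (λ x∈ → x∈))
                                  (Complement.spans N h∈K)))

  lift-confined : ∀ {K G o} → Flat K → Flat G → G ⊆ K → o ∈ G → CosetColours K G →
    (N : Complement ⊥ G K) → SomeConfined (Complement.set N) → SomeConfined K
  lift-confined {K} {G} fK fG G⊆K o∈G cosets N (i , F) =
    confined-∉ cl-flat (lift-⊆ below) (Complement.below N missing∈K) (lift-∉ flat below missing∈K missing∉)
      λ {z} z∈K κz → decidable-stable (z ∈? cl (set ∪ G)) λ z∉ →
        let k , k∈ , k∉ , κk = lift-colour missing∈K z∈K z∉ in k∉ (contains k∈ (trans κk κz))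
    where
    open Confined F
    open Lift fK fG G⊆K o∈G cosets N

  module Extension {a b c : Fin m} (a≢b : a ≢ b) (a≢c : a ≢ c) (b≢c : b ≢ c)
                (exhaust : ∀ i → i ≡ a ⊎ i ≡ b ⊎ i ≡ c) where

    exhaust′ : ∀ i → i ≡ b ⊎ i ≡ a ⊎ i ≡ c
    exhaust′ i with exhaust i
    ... | inj₁ eq        = inj₂ (inj₁ eq)
    ... | inj₂ (inj₁ eq) = inj₁ eq
    ... | inj₂ (inj₂ eq) = inj₂ (inj₂ eq)

    -- Here class `c` does not span `H`. Either it has no point of `K` off `H`, or `a` or `b` is
    -- missing from `H` outside `G`, or a coset of `G` is mixed, or colours are constant on the
    -- cosets of `G`. In the last case the induction hypothesis for a complement of `G` is lifted.
    extend : ∀ {K H o h₀} → Flat K → (hyp : Hyperplane K H) → (o∈H : o ∈ H) (κo : κ o ≡ c) →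
      h₀ ∈ H → h₀ ∉ cl (class H c) → Σ[ y ∈ Fin n ] y ∈ K × y ∉ H →
      (∀ {K′} → Flat K′ → Nonempty K′ → ∣ K′ ∣ < ∣ K ∣ → SomeConfined K′) → SomeConfined K
    extend {K} {H} fK hyp o∈H κo h₀∈H h₀∉G (y , y∈K , y∉H) smaller =
      choose (any? λ x → (x ∈? K) ×-dec ¬? (x ∈? H) ×-dec (κ x ≟ c))
        (outside-G? b) (outside-G? a) (mixed? a) (mixed? b)
      where
      open AcrossHyperplane fK hyp o∈H κo
      open Hyperplane hyp using () renaming (flat to fH; below to H⊆K)

      outside-G? : ∀ i → Dec (Σ[ h ∈ Fin n ] h ∈ H × h ∉ G × κ h ≡ i)
      outside-G? i = any? λ h → (h ∈? H) ×-dec ¬? (h ∈? G) ×-dec (κ h ≟ i)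

      Mixed : Fin m → Set
      Mixed i = Σ[ x ∈ Fin n ] Σ[ p ∈ Fin n ] x ∈ K × x ∉ H × κ x ≡ c × p ∈ G ⊕ x × p ∉ H × κ p ≡ i

      mixed? : ∀ i → Dec (Mixed i)
      mixed? i = any? λ x → any? λ p → (x ∈? K) ×-dec ¬? (x ∈? H) ×-dec (κ x ≟ c) ×-dec
                                       (p ∈? G ⊕ x) ×-dec ¬? (p ∈? H) ×-dec (κ p ≟ i)

      choose : Dec (Σ[ x ∈ Fin n ] x ∈ K × x ∉ H × κ x ≡ c) →
        Dec (Σ[ h ∈ Fin n ] h ∈ H × h ∉ G × κ h ≡ b) → Dec (Σ[ h ∈ Fin n ] h ∈ H × h ∉ G × κ h ≡ a) →
        Dec (Mixed a) → Dec (Mixed b) → SomeConfined K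
      choose (no ¬x) _ _ _ _ = confined-∉ fH H⊆K y∈K y∉H
        λ {x} x∈K κx → decidable-stable (x ∈? H) λ x∉H → ¬x (x , x∈K , x∉H , κx)
      choose (yes (x , x∈K , x∉H , κx)) (no ¬b) _ _ _ =
        confined-beside x∈K x∉H κx b≢c h₀∈H h₀∉G (λ h∈H h∉G κh → ¬b (_ , h∈H , h∉G , κh))
      choose (yes (x , x∈K , x∉H , κx)) (yes _) (no ¬a) _ _ =
        confined-beside x∈K x∉H κx a≢c h₀∈H h₀∉G (λ h∈H h∉G κh → ¬a (_ , h∈H , h∉G , κh))
      choose (yes _) (yes (_ , b₁∈H , b₁∉G , κb₁)) (yes _) (yes (_ , _ , x∈K , x∉H , κx , p∈ , p∉H , κp)) _ =
        MixedCoset.confined-c a≢b a≢c b≢c exhaust x∈K x∉H κx p∈ p∉H κp b₁∈H b₁∉G κb₁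
      choose (yes _) (yes _) (yes (_ , a₁∈H , a₁∉G , κa₁)) (no _) (yes (_ , _ , x∈K , x∉H , κx , p∈ , p∉H , κp)) =
        MixedCoset.confined-c (≢-sym a≢b) b≢c a≢c exhaust′ x∈K x∉H κx p∈ p∉H κp a₁∈H a₁∉G κa₁
      choose (yes _) (yes _) (yes _) (no ¬mixed-a) (no ¬mixed-b) =
        lift-confined fK cl-flat G⊆K o∈G (K-cosets pure) N
          (smaller (Complement.flat N) (complement-nonempty cl-flat N (H⊆K h₀∈H) h₀∉G)
                   (complement-smaller N o∈G (G⊆K o∈G)))
        where
        G⊆K : G ⊆ K
        G⊆K = H⊆K ∘ G⊆H
        N : Complement ⊥ G K
        N = complement flat-⊥ cl-flat fK (absurd ∘ ∉⊥)
        pure : ∀ {x p} → x ∈ K → x ∉ H → κ x ≡ c → p ∈ G ⊕ x → p ∉ H → κ p ≡ c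
        pure {x} {p} x∈K x∉H κx p∈ p∉H with exhaust (κ p)
        ... | inj₁ κp        = absurd (¬mixed-a (x , p , x∈K , x∉H , κx , p∈ , p∉H , κp))
        ... | inj₂ (inj₁ κp) = absurd (¬mixed-b (x , p , x∈K , x∉H , κx , p∈ , p∉H , κp))
        ... | inj₂ (inj₂ κp) = κp

  module ThreeColours {a b c : Fin m} (a≢b : a ≢ b) (a≢c : a ≢ c) (b≢c : b ≢ c)
                      (exhaust : ∀ i → i ≡ a ⊎ i ≡ b ⊎ i ≡ c) where

    rotate : ∀ i → i ≡ b ⊎ i ≡ c ⊎ i ≡ a
    rotate i with exhaust i
    ... | inj₁ eq        = inj₂ (inj₂ eq)
    ... | inj₂ (inj₁ eq) = inj₁ eq
    ... | inj₂ (inj₂ eq) = inj₂ (inj₁ eq)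

    rotate′ : ∀ i → i ≡ c ⊎ i ≡ a ⊎ i ≡ b
    rotate′ i with exhaust i
    ... | inj₁ eq        = inj₂ (inj₁ eq)
    ... | inj₂ (inj₁ eq) = inj₂ (inj₂ eq)
    ... | inj₂ (inj₂ eq) = inj₁ eq

    spanned-plane : ∀ {K xᵃ xᵇ xᶜ} → Flat K → xᵃ ∈ K → xᵇ ∈ K → xᶜ ∈ K → ¬ xᵃ ∥ xᵇ → xᶜ ∉ line xᵃ xᵇ →
      K ⊆ line xᵃ xᵇ ⊕ xᶜ → Plane K
    spanned-plane fK xᵃ∈K xᵇ∈K xᶜ∈K xᵃ∦xᵇ xᶜ∉ spans = record
      { flat = fK
      ; lines = line-hyperplane fK record
          { flat = cl-flat ; below = line-⊆ fK xᵃ∈K xᵇ∈K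
          ; spans = λ z∈K z∉ → ⊕-⊆ cl-flat ⊕-base (⊕-exchange cl-flat (spans z∈K) z∉) ∘ spans } }

    -- The hyperplane `H` is taken through points of all three colours, so that whichever colour is
    -- confined in it by induction has a point there, as `extend` demands. If the three points
    -- already span `K`, then `K` is a plane.
    some-confined : ∀ K → Acc _<_ ∣ K ∣ → Flat K → Nonempty K → SomeConfined K
    some-confined K (acc rec) fK (o , o∈K) = split (colour? a) (colour? b) (colour? c)
      where
      colour? : ∀ i → Dec (Σ[ x ∈ Fin n ] x ∈ K × κ x ≡ i)
      colour? i = any? (class? K i)

      absent : ∀ {i} → ¬ (Σ[ x ∈ Fin n ] x ∈ K × κ x ≡ i) → SomeConfined K
      absent ¬i = confined-∉ flat-⊥ (absurd ∘ ∉⊥) o∈K ∉⊥ λ x∈K κx → absurd (¬i (_ , x∈K , κx))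

      smaller : ∀ {K′} → Flat K′ → Nonempty K′ → ∣ K′ ∣ < ∣ K ∣ → SomeConfined K′
      smaller fK′ ne lt = some-confined _ (rec lt) fK′ ne

      split : Dec (Σ[ x ∈ Fin n ] x ∈ K × κ x ≡ a) → Dec (Σ[ x ∈ Fin n ] x ∈ K × κ x ≡ b) →
              Dec (Σ[ x ∈ Fin n ] x ∈ K × κ x ≡ c) → SomeConfined K
      split (no ¬a) _ _ = absent ¬a
      split (yes _) (no ¬b) _ = absent ¬b
      split (yes _) (yes _) (no ¬c) = absent ¬c
      split (yes (xᵃ , xᵃ∈K , κxᵃ)) (yes (xᵇ , xᵇ∈K , κxᵇ)) (yes (xᶜ , xᶜ∈K , κxᶜ))
        with any? (λ y → (y ∈? K) ×-dec ¬? (y ∈? line xᵃ xᵇ ⊕ xᶜ))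
      ... | no ¬y = confined-plane
            (spanned-plane fK xᵃ∈K xᵇ∈K xᶜ∈K (κ-∦ κxᵃ κxᵇ a≢b) (third-∉ κxᵃ κxᵇ κxᶜ a≢b a≢c b≢c)
              (λ {y} y∈K → decidable-stable (y ∈? _) λ y∉ → ¬y (y , y∈K , y∉)))
            a≢b a≢c b≢c xᵃ∈K xᵇ∈K xᶜ∈K κxᵃ κxᵇ κxᶜ
      ... | yes (y , y∈K , y∉)
            with H , hyp , abc⊆H , y∉H ← hyperplane-avoiding cl-flat fK
                   (⊕-⊆ fK (line-⊆ fK xᵃ∈K xᵇ∈K) xᶜ∈K) y∈K y∉
            = by-colour (smaller flat (xᶜ , xᶜ∈H) (p⊂q⇒∣p∣<∣q∣ (below , y , y∈K , y∉H)))
        where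
        open Hyperplane hyp
        xᵃ∈H : xᵃ ∈ H
        xᵃ∈H = abc⊆H (⊕-base line-left)
        xᵇ∈H : xᵇ ∈ H
        xᵇ∈H = abc⊆H (⊕-base line-right)
        xᶜ∈H : xᶜ ∈ H
        xᶜ∈H = abc⊆H ⊕-point
        missing∉G : ∀ {i} (F : Confined H i) → Confined.missing F ∉ cl (class H i)
        missing∉G F = Confined.missing∉ F ∘
          cl-min (Confined.flat F) (λ x∈ → Confined.contains F (class-⊆ x∈) (class-colour x∈))
        by-colour : SomeConfined H → SomeConfined K
        by-colour (i , F) with exhaust i
        -- The colour confined in `H` takes the part of `c` in `extend`; the rotations of `exhaust`
        -- reorder the colours to match.
        ... | inj₁ refl = Extension.extend b≢c (≢-sym a≢b) (≢-sym a≢c) rotate fK hyp xᵃ∈H κxᵃ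
                (Confined.missing∈K F) (missing∉G F) (y , y∈K , y∉H) smaller
        ... | inj₂ (inj₁ refl) = Extension.extend (≢-sym a≢c) (≢-sym b≢c) a≢b rotate′ fK hyp xᵇ∈H κxᵇ
                (Confined.missing∈K F) (missing∉G F) (y , y∈K , y∉H) smaller
        ... | inj₂ (inj₂ refl) = Extension.extend a≢b a≢c b≢c exhaust fK hyp xᶜ∈H κxᶜ
                (Confined.missing∈K F) (missing∉G F) (y , y∈K , y∉H) smaller

-- Merging colours and splitting off a two-coloured layer

recolour : ∀ {n m l} {Γ : ProjectiveGeometry n} {κ : Fin n → Fin m} (f : Fin m → Fin l) →
           RainbowFree Γ κ → RainbowFree Γ (f ∘ κ)
recolour f rf = record
  { parallel-colour = λ x∥y → cong f (parallel-colour x∥y)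
  ; line-colour = λ fκx≢fκy z∈ → Sum.map (cong f) (cong f) (line-colour (fκx≢fκy ∘ cong f) z∈) }
  where open RainbowFree rf

-- Reduces any number of colours to three, so that `some-confined` applies.
merge : ∀ {m} → Fin m → Fin m → Fin m → Fin 3
merge i j l with l ≟ i | l ≟ j
... | yes _ | _     = zero
... | no _  | yes _ = suc zero
... | no _  | no _  = suc (suc zero)

merge-left : ∀ {m} (i j : Fin m) → merge i j i ≡ zero
merge-left i j with i ≟ i
... | yes _ = refl
... | no i≢i = absurd (i≢i refl)

merge-right : ∀ {m} {i j : Fin m} → j ≢ i → merge i j j ≡ suc zero
merge-right {i = i} {j} j≢i with j ≟ i | j ≟ j
... | yes j≡i | _    = absurd (j≢i j≡i)
... | no _ | yes _   = refl
... | no _ | no j≢j  = absurd (j≢j refl)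

merge-rest : ∀ {m} {i j l : Fin m} → l ≢ i → l ≢ j → merge i j l ≡ suc (suc zero)
merge-rest {i = i} {j} {l} l≢i l≢j with l ≟ i | l ≟ j
... | yes l≡i | _      = absurd (l≢i l≡i)
... | no _ | yes l≡j   = absurd (l≢j l≡j)
... | no _ | no _      = refl

fin3 : ∀ (i : Fin 3) → i ≡ zero ⊎ i ≡ suc zero ⊎ i ≡ suc (suc zero)
fin3 zero             = inj₁ refl
fin3 (suc zero)       = inj₂ (inj₁ refl)
fin3 (suc (suc zero)) = inj₂ (inj₂ refl)

module TopLayer {n m : ℕ} {Γ : ProjectiveGeometry n} {κ : Fin n → Fin m} (rf : RainbowFree Γ κ) where
  open Gallai rf

  -- The two colours are named by points of `K`, so they are colours in use; `p` and `q` may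
  -- coincide.
  record TwoColouredLayer (K : Subset n) : Set where
    field
      set       : Subset n
      flat      : Flat set
      below     : set ⊆ K
      missing   : Fin n
      missing∈K : missing ∈ K
      missing∉  : missing ∉ set
      p q       : Fin n
      p∈K       : p ∈ K
      q∈K       : q ∈ K
      colours   : ∀ {x} → x ∈ K → x ∉ set → κ x ≡ κ p ⊎ κ x ≡ κ q

  two-coloured-flat : ∀ {K p q} → p ∈ K → q ∈ K → (∀ {x} → x ∈ K → κ x ≡ κ p ⊎ κ x ≡ κ q) → TwoColouredLayer K
  two-coloured-flat {K} {p} {q} p∈K q∈K col = record
    { set = ⊥ ; flat = flat-⊥ ; below = absurd ∘ ∉⊥ ; missing = p ; missing∈K = p∈K ; missing∉ = ∉⊥
    ; p = p ; q = q ; p∈K = p∈K ; q∈K = q∈K ; colours = λ x∈K _ → col x∈K }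


  -- Two colours of `K` are kept and the others merged. If the merged class lies in a proper flat,
  -- that flat serves; if one of the kept classes does, a complement of its span is a smaller flat,
  -- whose layer `quotient` lifts to `K`.
  top-layer : ∀ K → Acc _<_ ∣ K ∣ → Flat K → Nonempty K → TwoColouredLayer K
  top-layer K (acc rec) fK (p , p∈K) = second (any? λ q → (q ∈? K) ×-dec ¬? (κ q ≟ κ p))
    where
    quotient : ∀ {o F y} → o ∈ K → Flat F → F ⊆ K → y ∈ K → y ∉ F →
               (∀ {x} → x ∈ K → κ x ≡ κ o → x ∈ F) → TwoColouredLayer K
    quotient {o} {F} {y} o∈K fF F⊆K y∈K y∉F all = record
      { set = cl (set ∪ G) ; flat = cl-flat ; below = lift-⊆ below
      ; missing = missing ; missing∈K = N.below missing∈K ; missing∉ = lift-∉ flat below missing∈K missing∉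
      ; p = L.p ; q = q ; p∈K = N.below L.p∈K ; q∈K = N.below q∈K
      ; colours = λ x∈K x∉ →
          let k , k∈ , k∉ , κk = lift-colour missing∈K x∈K x∉
          in Sum.map (trans (sym κk)) (trans (sym κk)) (colours k∈ k∉) }
      where
      G : Subset n
      G = cl (class K (κ o))
      G⊆K : G ⊆ K
      G⊆K = cl-min fK class-⊆
      o∈G : o ∈ G
      o∈G = cl-ext (∈-class⁺ o∈K refl)
      y∉G : y ∉ G
      y∉G = y∉F ∘ cl-min fF (λ x∈ → all (class-⊆ x∈) (class-colour x∈))
      N : Complement ⊥ G K
      N = complement flat-⊥ cl-flat fK (absurd ∘ ∉⊥)
      module N = Complement N
      layer : TwoColouredLayer N.set
      layer = top-layer N.set (rec (complement-smaller N o∈G o∈K)) N.flat (complement-nonempty cl-flat N y∈K y∉G)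
      module L = TwoColouredLayer layer
      open L hiding (p; p∈K)
      open Lift fK cl-flat G⊆K o∈G (cl-class-cosets fK o∈K refl) N

    third-colour : ∀ {q} → q ∈ K → κ q ≢ κ p → TwoColouredLayer K
    third-colour {q} q∈K κq≢κp = by-colour
      (Merged.ThreeColours.some-confined {zero} {suc zero} {suc (suc zero)} (λ ()) (λ ()) (λ ()) fin3
        K (<-wellFounded _) fK (p , p∈K))
      where
      module Merged = Gallai (recolour (merge (κ p) (κ q)) rf)
      by-colour : Merged.SomeConfined K → TwoColouredLayer K
      by-colour (zero , F) = quotient p∈K flat below missing∈K missing∉
        λ x∈K κx → contains x∈K (trans (cong (merge (κ p) (κ q)) κx) (merge-left (κ p) (κ q)))
        where open Merged.Confined F
      by-colour (suc zero , F) = quotient q∈K flat below missing∈K missing∉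
        λ x∈K κx → contains x∈K (trans (cong (merge (κ p) (κ q)) κx) (merge-right κq≢κp))
        where open Merged.Confined F
      by-colour (suc (suc zero) , F) = record
        { set = set ; flat = flat ; below = below
        ; missing = missing ; missing∈K = missing∈K ; missing∉ = missing∉
        ; p = p ; q = q ; p∈K = p∈K ; q∈K = q∈K ; colours = colours }
        where
        open Merged.Confined F
        colours : ∀ {x} → x ∈ K → x ∉ set → κ x ≡ κ p ⊎ κ x ≡ κ q
        colours {x} x∈K x∉ with κ x ≟ κ p | κ x ≟ κ q
        ... | yes eq | _ = inj₁ eq
        ... | no _ | yes eq = inj₂ eq
        ... | no ≢p | no ≢q = absurd (x∉ (contains x∈K (merge-rest ≢p ≢q)))

    second : Dec (Σ[ q ∈ Fin n ] q ∈ K × κ q ≢ κ p) → TwoColouredLayer K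
    second (yes (q , q∈K , κq≢κp)) = third-colour q∈K κq≢κp
    second (no ¬q) = two-coloured-flat p∈K p∈K
      λ {x} x∈K → inj₁ (decidable-stable (κ x ≟ κ p) λ κx≢ → ¬q (x , x∈K , κx≢))

-- The geometry of a modular connected matroid

∣p∪q∣≤∣p∣+∣q∣ : ∀ {n} (p q : Subset n) → ∣ p ∪ q ∣ ≤ ∣ p ∣ + ∣ q ∣
∣p∪q∣≤∣p∣+∣q∣ []          []          = z≤n
∣p∪q∣≤∣p∣+∣q∣ (true  ∷ p) (true  ∷ q) = s≤s (≤-trans (∣p∪q∣≤∣p∣+∣q∣ p q) (+-monoʳ-≤ ∣ p ∣ (ℕ.n≤1+n ∣ q ∣)))
∣p∪q∣≤∣p∣+∣q∣ (true  ∷ p) (false ∷ q) = s≤s (∣p∪q∣≤∣p∣+∣q∣ p q)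
∣p∪q∣≤∣p∣+∣q∣ (false ∷ p) (true  ∷ q) = ≤-trans (s≤s (∣p∪q∣≤∣p∣+∣q∣ p q)) (≤-reflexive (sym (+-suc ∣ p ∣ ∣ q ∣)))
∣p∪q∣≤∣p∣+∣q∣ (false ∷ p) (false ∷ q) = ∣p∪q∣≤∣p∣+∣q∣ p q

p⊆q⇒∣p∣+∣q─p∣≤∣q∣ : ∀ {n} {p q : Subset n} → p ⊆ q → ∣ p ∣ + ∣ q ─ p ∣ ≤ ∣ q ∣
p⊆q⇒∣p∣+∣q─p∣≤∣q∣ {p = []}        {[]}        p⊆q = z≤n
p⊆q⇒∣p∣+∣q─p∣≤∣q∣ {p = true  ∷ p} {true  ∷ q} p⊆q = s≤s (p⊆q⇒∣p∣+∣q─p∣≤∣q∣ (drop-∷-⊆ p⊆q))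
p⊆q⇒∣p∣+∣q─p∣≤∣q∣ {p = true  ∷ p} {false ∷ q} p⊆q with p⊆q here
... | ()
p⊆q⇒∣p∣+∣q─p∣≤∣q∣ {p = false ∷ p} {true  ∷ q} p⊆q =
  ≤-trans (≤-reflexive (+-suc ∣ p ∣ ∣ q ─ p ∣)) (s≤s (p⊆q⇒∣p∣+∣q─p∣≤∣q∣ (drop-∷-⊆ p⊆q)))
p⊆q⇒∣p∣+∣q─p∣≤∣q∣ {p = false ∷ p} {false ∷ q} p⊆q = p⊆q⇒∣p∣+∣q─p∣≤∣q∣ (drop-∷-⊆ p⊆q)

p⊆[p-x]∪⁅x⁆ : ∀ {n} (p : Subset n) x → p ⊆ (p - x) ∪ ⁅ x ⁆
p⊆[p-x]∪⁅x⁆ p x {y} y∈p with y ≟ x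
... | yes refl = q⊆p∪q (p - x) ⁅ x ⁆ (x∈⁅x⁆ x)
... | no y≢x   = p⊆p∪q ⁅ x ⁆ (x∈p∧x≢y⇒x∈p-y y∈p y≢x)

x∈p-y⇒x∈p : ∀ {n} {p : Subset n} {x y} → x ∈ p - y → x ∈ p
x∈p-y⇒x∈p {p = p} {y = y} = p─q⊆p p ⁅ y ⁆

x∉p-x : ∀ {n} (p : Subset n) x → x ∉ p - x
x∉p-x p x x∈ = ℕ.<-irrefl (cong ∣_∣ (p─q─q≡p─q p ⁅ x ⁆)) (x∈p⇒∣p-x∣<∣p∣ x∈)

∣p∣≤1+∣p-x∣ : ∀ {n} (p : Subset n) x → ∣ p ∣ ≤ suc ∣ p - x ∣
∣p∣≤1+∣p-x∣ p x = begin
  ∣ p ∣                   ≤⟨ p⊆q⇒∣p∣≤∣q∣ (p⊆[p-x]∪⁅x⁆ p x) ⟩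
  ∣ (p - x) ∪ ⁅ x ⁆ ∣     ≤⟨ ∣p∪q∣≤∣p∣+∣q∣ (p - x) ⁅ x ⁆ ⟩
  ∣ p - x ∣ + ∣ ⁅ x ⁆ ∣   ≡⟨ cong (∣ p - x ∣ +_) (∣⁅x⁆∣≡1 x) ⟩
  ∣ p - x ∣ + 1           ≡⟨ +-comm ∣ p - x ∣ 1 ⟩
  suc ∣ p - x ∣           ∎
  where open ≤-Reasoning

module MatroidClosure {n : ℕ} (M : Matroid n) where

  rk : Subset n → ℕ
  rk = r M

  submodular : ∀ {A B X Y} → A ⊆ X ∪ Y → B ⊆ X → B ⊆ Y → rk A + rk B ≤ rk X + rk Y
  submodular {A} {B} {X} {Y} A⊆ B⊆X B⊆Y = ≤-trans
    (+-mono-≤ (r-mono M A (X ∪ Y) A⊆) (r-mono M B (X ∩ Y) (λ x∈ → x∈p∩q⁺ (B⊆X x∈ , B⊆Y x∈))))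
    (r-submod M X Y)

  closed? : ∀ X z → Dec (rk (X ∪ ⁅ z ⁆) ≤ rk X)
  closed? X z = rk (X ∪ ⁅ z ⁆) ℕ.≤? rk X

  cl : Subset n → Subset n
  cl X = sieve (closed? X)

  ∈-cl⁺ : ∀ {X z} → rk (X ∪ ⁅ z ⁆) ≤ rk X → z ∈ cl X
  ∈-cl⁺ {X} = ∈-sieve⁺ (closed? X)

  ∈-cl⁻ : ∀ {X z} → z ∈ cl X → rk (X ∪ ⁅ z ⁆) ≤ rk X
  ∈-cl⁻ {X} = ∈-sieve⁻ (closed? X)

  cl-ext : ∀ {X} → X ⊆ cl X
  cl-ext {X} x∈ = ∈-cl⁺ (r-mono M _ _ (∪-⊆ id (⁅⁆⊆ x∈)))

  rank-absorb : ∀ {X Y} → Y ⊆ cl X → rk (X ∪ Y) ≤ rk X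
  rank-absorb {X} {Y} Y⊆ = ≤-trans
    (r-mono M _ _ (∪-⊆ (p⊆p∪q _) (q⊆p∪q X _ ∘ ⊆-elements Y)))
    (go (elements Y) (All.map Y⊆ (elements-∈ Y)))
    where
    go : ∀ xs → All (_∈ cl X) xs → rk (X ∪ fromList xs) ≤ rk X
    go [] _ = r-mono M _ _ (∪-⊆ id (absurd ∘ ∉⊥))
    go (x ∷ xs) (x∈ ∷ xs∈) = +-cancelʳ-≤ (rk X) _ _ (≤-trans
      (submodular {X = X ∪ fromList xs} {X ∪ ⁅ x ⁆}
        (∪-⊆ (p⊆p∪q _ ∘ p⊆p∪q _) (∪-⊆ (p⊆p∪q _ ∘ q⊆p∪q X _) (q⊆p∪q _ _ ∘ q⊆p∪q X _)))
        (p⊆p∪q _) (p⊆p∪q _))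
      (+-mono-≤ (go xs xs∈) (∈-cl⁻ x∈)))

  rank-⊆-cl : ∀ {X Y} → Y ⊆ cl X → rk Y ≤ rk X
  rank-⊆-cl {X} {Y} Y⊆ = ≤-trans (r-mono M _ _ (q⊆p∪q X Y)) (rank-absorb Y⊆)

  cl-least : ∀ {X Y} → X ⊆ cl Y → cl X ⊆ cl Y
  cl-least {X} {Y} X⊆ {z} z∈ = ∈-cl⁺ (+-cancelʳ-≤ (rk X) _ _ (≤-trans
    (submodular {X = Y ∪ X} {X ∪ ⁅ z ⁆} (∪-⊆ (p⊆p∪q _ ∘ p⊆p∪q X) (q⊆p∪q _ _ ∘ q⊆p∪q X _)) (q⊆p∪q Y X) (p⊆p∪q _))
    (+-mono-≤ (rank-absorb X⊆) (∈-cl⁻ z∈))))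

  rank-⁅⁆ : ∀ x → rk ⁅ x ⁆ ≤ 1
  rank-⁅⁆ x = ≤-trans (r-bound M ⁅ x ⁆) (≤-reflexive (∣⁅x⁆∣≡1 x))

  rank-step : ∀ X x → rk (X ∪ ⁅ x ⁆) ≤ suc (rk X)
  rank-step X x = begin
    rk (X ∪ ⁅ x ⁆)          ≤⟨ m≤m+n _ _ ⟩
    rk (X ∪ ⁅ x ⁆) + rk ⊥   ≤⟨ submodular id (absurd ∘ ∉⊥) (absurd ∘ ∉⊥) ⟩
    rk X + rk ⁅ x ⁆         ≤⟨ +-monoʳ-≤ (rk X) (rank-⁅⁆ x) ⟩
    rk X + 1                ≡⟨ +-comm (rk X) 1 ⟩
    suc (rk X)              ∎
    where open ≤-Reasoning

  ∉-cl : ∀ {X z} → z ∉ cl X → rk X < rk (X ∪ ⁅ z ⁆)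
  ∉-cl z∉ = ≰⇒> (z∉ ∘ ∈-cl⁺)

  exchange : ∀ {X x y} → y ∈ cl (X ∪ ⁅ x ⁆) → y ∉ cl X → x ∈ cl (X ∪ ⁅ y ⁆)
  exchange {X} {x} {y} y∈ y∉ = ∈-cl⁺ (begin
    rk ((X ∪ ⁅ y ⁆) ∪ ⁅ x ⁆)    ≤⟨ r-mono M _ _ (∪-⊆ (∪-⊆ (p⊆p∪q _ ∘ p⊆p∪q _) (q⊆p∪q _ _))
                                                   (p⊆p∪q _ ∘ q⊆p∪q X _)) ⟩
    rk ((X ∪ ⁅ x ⁆) ∪ ⁅ y ⁆)    ≤⟨ ∈-cl⁻ y∈ ⟩
    rk (X ∪ ⁅ x ⁆)              ≤⟨ rank-step X x ⟩
    suc (rk X)                  ≤⟨ ∉-cl y∉ ⟩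
    rk (X ∪ ⁅ y ⁆)              ∎)
    where open ≤-Reasoning

  flat⇒isFlat : ∀ {F} → cl F ⊆ F → IsFlat M F
  flat⇒isFlat fF e e∉F = ∉-cl (e∉F ∘ fF)

  isFlat⇒flat : ∀ {F} → IsFlat M F → cl F ⊆ F
  isFlat⇒flat {F} fF {z} z∈ = decidable-stable (z ∈? F) λ z∉F → <⇒≱ (fF z z∉F) (∈-cl⁻ z∈)

  Independent : Subset n → Set
  Independent X = ∣ X ∣ ≤ rk X

  independent-⊆ : ∀ {X Y} → X ⊆ Y → Independent Y → Independent X
  independent-⊆ {X} {Y} X⊆Y ind = +-cancelʳ-≤ ∣ Y ─ X ∣ _ _ (begin
    ∣ X ∣ + ∣ Y ─ X ∣           ≤⟨ p⊆q⇒∣p∣+∣q─p∣≤∣q∣ X⊆Y ⟩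
    ∣ Y ∣                       ≤⟨ ind ⟩
    rk Y                        ≤⟨ m≤m+n _ _ ⟩
    rk Y + rk ⊥                 ≤⟨ submodular Y⊆ (absurd ∘ ∉⊥) (absurd ∘ ∉⊥) ⟩
    rk X + rk (Y ─ X)           ≤⟨ +-monoʳ-≤ (rk X) (r-bound M (Y ─ X)) ⟩
    rk X + ∣ Y ─ X ∣            ∎)
    where
    open ≤-Reasoning
    Y⊆ : Y ⊆ X ∪ (Y ─ X)
    Y⊆ {z} z∈Y with z ∈? X
    ... | yes z∈X = p⊆p∪q (Y ─ X) z∈X
    ... | no z∉X  = q⊆p∪q X (Y ─ X) (x∈p∧x∉q⇒x∈p─q z∈Y z∉X)

  circuit : ∀ {Y} → Dependent M Y → (∀ w → w ∈ Y → Independent (Y - w)) → IsCircuit M Y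
  circuit {Y} dep ind = dep , minimal
    where
    minimal : ∀ X → X ⊆ Y → X ≢ Y → ¬ Dependent M X
    minimal X X⊆Y X≢Y with any? (λ w → (w ∈? Y) ×-dec ¬? (w ∈? X))
    ... | yes (w , w∈Y , w∉X) =
          ℕ.≤⇒≯ (independent-⊆ (λ x∈X → x∈p∧x≢y⇒x∈p-y (X⊆Y x∈X) λ { refl → w∉X x∈X }) (ind w w∈Y))
    ... | no ¬w = absurd (X≢Y (⊆-antisym X⊆Y
            λ {w} w∈Y → decidable-stable (w ∈? X) λ w∉X → ¬w (w , w∈Y , w∉X)))

  circuit-dependence : ∀ {D w x} → IsCircuit M D → w ∈ D → x ∈ D → x ≢ w → x ∉ cl (D - w - x)
  circuit-dependence {D} {w} {x} (_ , minimal) w∈D x∈D x≢w x∈ =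
    minimal (D - w) x∈p-y⇒x∈p (λ eq → x∉p-x D w (subst (w ∈_) (sym eq) w∈D)) (begin-strict
      rk (D - w)         ≤⟨ rank-⊆-cl (∪-⊆ cl-ext (⁅⁆⊆ x∈) ∘ p⊆[p-x]∪⁅x⁆ (D - w) x) ⟩
      rk (D - w - x)     ≤⟨ r-bound M _ ⟩
      ∣ D - w - x ∣      <⟨ x∈p⇒∣p-x∣<∣p∣ (x∈p∧x≢y⇒x∈p-y x∈D x≢w) ⟩
      ∣ D - w ∣          ∎)
    where open ≤-Reasoning

  rank-empty : ∀ {X} → Empty X → rk X ≡ 0
  rank-empty {X} empty = ℕ.n≤0⇒n≡0 (begin
    rk X       ≤⟨ r-bound M X ⟩
    ∣ X ∣      ≡⟨ cong ∣_∣ (Empty-unique empty) ⟩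
    ∣ ⊥ {n} ∣  ≡⟨ ∣⊥∣≡0 n ⟩
    0          ∎)
    where open ≤-Reasoning

  module Loopless (noLoop : ∀ e → ¬ IsLoop M e) where

    rank-point : ∀ x → 1 ≤ rk ⁅ x ⁆
    rank-point x = ℕ.n≢0⇒n>0 (noLoop x)

    loopless : ∀ {x} → x ∉ cl ⊥
    loopless {x} x∈ = noLoop x (ℕ.n≤0⇒n≡0 (begin
      rk ⁅ x ⁆  ≤⟨ rank-⊆-cl (⁅⁆⊆ x∈) ⟩
      rk ⊥      ≡⟨ rank-empty (λ (_ , x∈) → ∉⊥ x∈) ⟩
      0         ∎))
      where open ≤-Reasoning

    rank-line : ∀ {x y} → y ∉ cl ⁅ x ⁆ → 2 ≤ rk (⁅ x ⁆ ∪ ⁅ y ⁆)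
    rank-line {x} y∉ = ≤-trans (s≤s (rank-point x)) (∉-cl y∉)

    ∥-sym : ∀ {x y} → y ∈ cl ⁅ x ⁆ → x ∈ cl ⁅ y ⁆
    ∥-sym {x} {y} y∈ = cl-least (∪-⊆ (absurd ∘ ∉⊥) cl-ext)
      (exchange (cl-least (cl-ext ∘ q⊆p∪q ⊥ ⁅ x ⁆) y∈) loopless)

    module Modularity (modular : Modular M) where

      modular-flats : ∀ {F G} → cl F ⊆ F → cl G ⊆ G → rk F + rk G ≡ rk (F ∪ G) + rk (F ∩ G)
      modular-flats fF fG = modular _ _ (flat⇒isFlat fF) (flat⇒isFlat fG)

      cl-flat : ∀ {X} → cl (cl X) ⊆ cl X
      cl-flat = cl-least id

      -- Were the intersection empty, modularity would give `F ∪ G` the rank `rk F + rk G`, more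
      -- than that of a set `R` spanning both.
      meet-point : ∀ {F G R} → cl F ⊆ F → cl G ⊆ G → F ⊆ cl R → G ⊆ cl R → rk R < rk F + rk G →
                   Nonempty (F ∩ G)
      meet-point {F} {G} {R} fF fG F⊆ G⊆ lt with nonempty? (F ∩ G)
      ... | yes ne = ne
      ... | no empty = absurd (<⇒≱ lt (begin
            rk F + rk G                ≡⟨ modular-flats fF fG ⟩
            rk (F ∪ G) + rk (F ∩ G)    ≡⟨ cong (rk (F ∪ G) +_) (rank-empty empty) ⟩
            rk (F ∪ G) + 0             ≡⟨ +-identityʳ _ ⟩
            rk (F ∪ G)                 ≤⟨ rank-⊆-cl (∪-⊆ F⊆ G⊆) ⟩
            rk R                       ∎))
        where open ≤-Reasoning

      line-meet : ∀ {F g z} → cl F ⊆ F → g ∈ cl (F ∪ ⁅ z ⁆) → z ∉ cl ⁅ g ⁆ →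
                  Nonempty (F ∩ cl (⁅ g ⁆ ∪ ⁅ z ⁆))
      line-meet {F} {g} {z} fF g∈ g∦z = meet-point {R = F ∪ ⁅ z ⁆} fF cl-flat
        (cl-ext ∘ p⊆p∪q _) (cl-least (∪-⊆ (⁅⁆⊆ g∈) (cl-ext ∘ q⊆p∪q F _))) (begin-strict
          rk (F ∪ ⁅ z ⁆)                  ≤⟨ rank-step F z ⟩
          suc (rk F)                      <⟨ ≤-refl ⟩
          2 + rk F                        ≡⟨ +-comm 2 (rk F) ⟩
          rk F + 2                        ≤⟨ +-monoʳ-≤ (rk F) (≤-trans (rank-line g∦z) (r-mono M _ _ cl-ext)) ⟩
          rk F + rk (cl (⁅ g ⁆ ∪ ⁅ z ⁆))  ∎)
        where open ≤-Reasoning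

      -- For `z` off `F`, a point `g′` of `G` is sought in the span of `F` and `z` but off `F`.
      -- Unless `g′` is parallel to `z`, the line `g′ z` then meets `F`, and exchange puts `z` on
      -- `f′ g′`.
      join : ∀ {F G f g z} → cl F ⊆ F → cl G ⊆ G → f ∈ F → g ∈ G → z ∈ cl (F ∪ G) →
             Σ[ f′ ∈ Fin n ] Σ[ g′ ∈ Fin n ] f′ ∈ F × g′ ∈ G × z ∈ cl (⁅ f′ ⁆ ∪ ⁅ g′ ⁆)
      join {F} {G} {f} {g} {z} fF fG f∈F g∈G z∈ with z ∈? F
      ... | yes z∈F = z , g , z∈F , g∈G , cl-ext (p⊆p∪q _ (x∈⁅x⁆ z))
      ... | no z∉F with any? (λ g′ → (g′ ∈? cl (F ∪ ⁅ z ⁆)) ×-dec (g′ ∈? G) ×-dec ¬? (g′ ∈? F))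
      -- Without such a `g′`, the flats `Fz` and `F` have the same join and the same meet with `G`,
      -- so modularity forces equal ranks and `z ∈ F`.
      ...   | no ¬g′ = absurd (z∉F (fF (∈-cl⁺ (≤-trans (r-mono M _ _ cl-ext) (+-cancelʳ-≤ (rk G) _ _ (begin
                rk Fz + rk G                ≡⟨ modular-flats cl-flat fG ⟩
                rk (Fz ∪ G) + rk (Fz ∩ G)   ≤⟨ +-mono-≤ (rank-⊆-cl Fz∪G⊆) (r-mono M _ _ Fz∩G⊆) ⟩
                rk (F ∪ G) + rk (F ∩ G)     ≡⟨ modular-flats fF fG ⟨
                rk F + rk G                 ∎))))))
        where
        open ≤-Reasoning
        Fz : Subset n
        Fz = cl (F ∪ ⁅ z ⁆)
        Fz∪G⊆ : Fz ∪ G ⊆ cl (F ∪ G)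
        Fz∪G⊆ = ∪-⊆ (cl-least (∪-⊆ (cl-ext ∘ p⊆p∪q G) (⁅⁆⊆ z∈))) (cl-ext ∘ q⊆p∪q F G)
        Fz∩G⊆ : Fz ∩ G ⊆ F ∩ G
        Fz∩G⊆ {x} x∈ with x∈Fz , x∈G ← x∈p∩q⁻ Fz G x∈ =
          x∈p∩q⁺ (decidable-stable (x ∈? F) (λ x∉F → ¬g′ (x , x∈Fz , x∈G , x∉F)) , x∈G)
      ...   | yes (g′ , g′∈Fz , g′∈G , g′∉F) with z ∈? cl ⁅ g′ ⁆
      ...     | yes g′∥z = f , g′ , f∈F , g′∈G , cl-least (cl-ext ∘ q⊆p∪q ⁅ f ⁆ ⁅ g′ ⁆) g′∥z
      ...     | no g′∦z with f′ , f′∈ ← line-meet fF g′∈Fz g′∦z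
                with f′∈F , f′∈g′z ← x∈p∩q⁻ F _ f′∈
                = f′ , g′ , f′∈F , g′∈G
                , cl-least (∪-⊆ (cl-ext ∘ q⊆p∪q _ _) (cl-ext ∘ p⊆p∪q _))
                    (exchange f′∈g′z λ g′∥f′ → g′∉F (fF (cl-least (cl-ext ∘ ⁅⁆⊆ f′∈F) (∥-sym g′∥f′))))

      circuit-rank : ∀ {D x y} → IsCircuit M D → x ∈ D → y ∈ D → y ∉ cl ⁅ x ⁆ →
                     rk D < rk (cl (D - x - y)) + rk (cl (⁅ x ⁆ ∪ ⁅ y ⁆))
      circuit-rank {D} {x} {y} (dep , minimal) x∈D y∈D x∦y = begin-strict
        rk D                                               <⟨ dep ⟩
        ∣ D ∣                                              ≤⟨ ∣p∣≤1+∣p-x∣ D x ⟩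
        suc ∣ D - x ∣                                      ≤⟨ s≤s (∣p∣≤1+∣p-x∣ (D - x) y) ⟩
        2 + ∣ D - x - y ∣                                  ≡⟨ +-comm 2 _ ⟩
        ∣ D - x - y ∣ + 2                                  ≤⟨ +-mono-≤ independent (rank-line x∦y) ⟩
        rk (D - x - y) + rk (⁅ x ⁆ ∪ ⁅ y ⁆)                ≤⟨ +-mono-≤ (r-mono M _ _ cl-ext) (r-mono M _ _ cl-ext) ⟩
        rk (cl (D - x - y)) + rk (cl (⁅ x ⁆ ∪ ⁅ y ⁆))      ∎
        where
        open ≤-Reasoning
        independent : Independent (D - x - y)
        independent = ≮⇒≥ (minimal (D - x - y) (x∈p-y⇒x∈p ∘ x∈p-y⇒x∈p)
          λ eq → x∉p-x (D - x) y (subst (y ∈_) (sym eq) y∈D))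

      -- For a circuit `D` through `x` and `y`, the ranks of the line `x y` and of the span of
      -- `D - x - y` add up to more than `rk D`, so the two meet in a point `z`. Were `z` parallel
      -- to `x` or `y`, that element would be spanned by `D - x - y`, which a circuit forbids.
      third : Connected M → ∀ {x y} → y ∉ cl ⁅ x ⁆ →
              Σ[ z ∈ Fin n ] z ∈ cl (⁅ x ⁆ ∪ ⁅ y ⁆) × z ∉ cl ⁅ x ⁆ × z ∉ cl ⁅ y ⁆
      third connected {x} {y} x∦y
        with D , circ@(dep , minimal) , x∈D , y∈D ← connected x y (λ { refl → x∦y (cl-ext (x∈⁅x⁆ x)) })
        with z , z∈ ← meet-point {cl (D - x - y)} {cl (⁅ x ⁆ ∪ ⁅ y ⁆)} {D} cl-flat cl-flat
               (cl-least (cl-ext ∘ x∈p-y⇒x∈p ∘ x∈p-y⇒x∈p))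
               (cl-least (cl-ext ∘ ∪-⊆ (⁅⁆⊆ x∈D) (⁅⁆⊆ y∈D))) (circuit-rank circ x∈D y∈D x∦y)
        with z∈B , z∈xy ← x∈p∩q⁻ _ _ z∈
        = z , z∈xy
        , (λ x∥z → circuit-dependence circ y∈D x∈D x≢y
             (subst (λ B → x ∈ cl B) (p─x─y≡p─y─x D x y) (cl-least (⁅⁆⊆ z∈B) (∥-sym x∥z))))
        , (λ y∥z → circuit-dependence circ x∈D y∈D (≢-sym x≢y) (cl-least (⁅⁆⊆ z∈B) (∥-sym y∥z)))
        where
        x≢y : x ≢ y
        x≢y refl = x∦y (cl-ext (x∈⁅x⁆ x))

-- Small circuits and rainbow triangles

module MatroidGeometry {n : ℕ} (M : Matroid n) (noLoop : ∀ e → ¬ IsLoop M e)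
                       (modular : Modular M) (connected : Connected M) where
  open MatroidClosure M
  open Loopless noLoop
  open Modularity modular

  geometry : ProjectiveGeometry n
  geometry = record
    { cl = cl ; cl-ext = cl-ext ; cl-least = cl-least ; exchange = exchange ; loopless = loopless
    ; join = join ; third = third connected }

  open ProjectiveGeometry geometry using (_∥_; line)

  independent-⁅⁆ : ∀ x → Independent ⁅ x ⁆
  independent-⁅⁆ x = ≤-trans (≤-reflexive (∣⁅x⁆∣≡1 x)) (rank-point x)

  independent-pair : ∀ {x y} → ¬ x ∥ y → Independent (⁅ x ⁆ ∪ ⁅ y ⁆)
  independent-pair {x} {y} x∦y = ≤-trans (∣p∪q∣≤∣p∣+∣q∣ ⁅ x ⁆ ⁅ y ⁆)
    (≤-trans (≤-reflexive (cong₂ _+_ (∣⁅x⁆∣≡1 x) (∣⁅x⁆∣≡1 y))) (rank-line x∦y))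

  removed : ∀ {Z A : Subset n} {x} → Z ⊆ A ∪ ⁅ x ⁆ → Z - x ⊆ A
  removed {Z} {A} {x} Z⊆ {z} z∈ with x∈p∪q⁻ A ⁅ x ⁆ (Z⊆ (x∈p-y⇒x∈p z∈))
  ... | inj₁ z∈A = z∈A
  ... | inj₂ z∈x with refl ← x∈⁅y⁆⇒x≡y x z∈x = absurd (x∉p-x Z x z∈)

  ∣pair∣ : ∀ {x y : Fin n} → x ≢ y → 2 ≤ ∣ ⁅ x ⁆ ∪ ⁅ y ⁆ ∣
  ∣pair∣ {x} {y} x≢y = ≤-trans (≤-reflexive (cong suc (sym (∣⁅x⁆∣≡1 x))))
    (p⊂q⇒∣p∣<∣q∣ (p⊆p∪q ⁅ y ⁆ , y , q⊆p∪q ⁅ x ⁆ ⁅ y ⁆ (x∈⁅x⁆ y) , x≢y ∘ sym ∘ x∈⁅y⁆⇒x≡y x))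

  circuit-pair : ∀ {x y} → x ≢ y → x ∥ y → IsCircuit M (⁅ x ⁆ ∪ ⁅ y ⁆)
  circuit-pair {x} {y} x≢y x∥y = circuit (ℕ.<-≤-trans (s≤s (≤-trans (∈-cl⁻ x∥y) (rank-⁅⁆ x))) (∣pair∣ x≢y)) minus
    where
    minus : ∀ w → w ∈ ⁅ x ⁆ ∪ ⁅ y ⁆ → Independent (⁅ x ⁆ ∪ ⁅ y ⁆ - w)
    minus w w∈ with x∈p∪q⁻ ⁅ x ⁆ ⁅ y ⁆ w∈
    ... | inj₁ w∈x with refl ← x∈⁅y⁆⇒x≡y x w∈x =
          independent-⊆ (removed (∪-⊆ (q⊆p∪q ⁅ y ⁆ ⁅ x ⁆) (p⊆p∪q ⁅ x ⁆))) (independent-⁅⁆ y)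
    ... | inj₂ w∈y with refl ← x∈⁅y⁆⇒x≡y y w∈y = independent-⊆ (removed id) (independent-⁅⁆ x)

  triple : Fin n → Fin n → Fin n → Subset n
  triple x y z = (⁅ x ⁆ ∪ ⁅ y ⁆) ∪ ⁅ z ⁆

  ∈-triple⁻ : ∀ {x y z w} → w ∈ triple x y z → w ≡ x ⊎ w ≡ y ⊎ w ≡ z
  ∈-triple⁻ {x} {y} {z} w∈ with x∈p∪q⁻ (⁅ x ⁆ ∪ ⁅ y ⁆) ⁅ z ⁆ w∈
  ... | inj₂ w∈z = inj₂ (inj₂ (x∈⁅y⁆⇒x≡y z w∈z))
  ... | inj₁ w∈xy with x∈p∪q⁻ ⁅ x ⁆ ⁅ y ⁆ w∈xy
  ...   | inj₁ w∈x = inj₁ (x∈⁅y⁆⇒x≡y x w∈x)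
  ...   | inj₂ w∈y = inj₂ (inj₁ (x∈⁅y⁆⇒x≡y y w∈y))

  ∣triple∣ : ∀ {x y z} → x ≢ y → x ≢ z → y ≢ z → ∣ triple x y z ∣ ≡ 3
  ∣triple∣ {x} {y} {z} x≢y x≢z y≢z = ℕ.≤-antisym upper
    (≤-trans (s≤s (∣pair∣ x≢y)) (p⊂q⇒∣p∣<∣q∣ (p⊆p∪q ⁅ z ⁆ , z , q⊆p∪q _ ⁅ z ⁆ (x∈⁅x⁆ z) , z∉)))
    where
    upper : ∣ triple x y z ∣ ≤ 3
    upper = ≤-trans (∣p∪q∣≤∣p∣+∣q∣ (⁅ x ⁆ ∪ ⁅ y ⁆) ⁅ z ⁆)
      (+-mono-≤ (≤-trans (∣p∪q∣≤∣p∣+∣q∣ ⁅ x ⁆ ⁅ y ⁆) (≤-reflexive (cong₂ _+_ (∣⁅x⁆∣≡1 x) (∣⁅x⁆∣≡1 y))))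
                (≤-reflexive (∣⁅x⁆∣≡1 z)))
    z∉ : z ∉ ⁅ x ⁆ ∪ ⁅ y ⁆
    z∉ z∈ with x∈p∪q⁻ ⁅ x ⁆ ⁅ y ⁆ z∈
    ... | inj₁ z∈x = x≢z (sym (x∈⁅y⁆⇒x≡y x z∈x))
    ... | inj₂ z∈y = y≢z (sym (x∈⁅y⁆⇒x≡y y z∈y))

  circuit-triple : ∀ {x y z} → x ≢ y → x ≢ z → y ≢ z → ¬ x ∥ y → ¬ x ∥ z → ¬ y ∥ z → z ∈ line x y →
                   IsCircuit M (triple x y z)
  circuit-triple {x} {y} {z} x≢y x≢z y≢z x∦y x∦z y∦z z∈ = circuit dependent minus
    where
    open ≤-Reasoning
    dependent : Dependent M (triple x y z)
    dependent = begin-strict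
      rk (triple x y z)         ≤⟨ ∈-cl⁻ z∈ ⟩
      rk (⁅ x ⁆ ∪ ⁅ y ⁆)        ≤⟨ rank-step ⁅ x ⁆ y ⟩
      suc (rk ⁅ x ⁆)            ≤⟨ s≤s (rank-⁅⁆ x) ⟩
      2                         <⟨ ≤-refl ⟩
      3                         ≡⟨ ∣triple∣ x≢y x≢z y≢z ⟨
      ∣ triple x y z ∣          ∎
    ∪-swap : ∀ {A B X : Subset n} → (A ∪ B) ∪ X ⊆ (A ∪ X) ∪ B
    ∪-swap = ∪-⊆ (∪-⊆ (p⊆p∪q _ ∘ p⊆p∪q _) (q⊆p∪q _ _)) (p⊆p∪q _ ∘ q⊆p∪q _ _)
    ∪-comm′ : ∀ {A B : Subset n} → A ∪ B ⊆ B ∪ A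
    ∪-comm′ = ∪-⊆ (q⊆p∪q _ _) (p⊆p∪q _)
    minus : ∀ w → w ∈ triple x y z → Independent (triple x y z - w)
    minus w w∈ with ∈-triple⁻ w∈
    ... | inj₂ (inj₂ refl) = independent-⊆ (removed id) (independent-pair x∦y)
    ... | inj₂ (inj₁ refl) = independent-⊆ (removed ∪-swap) (independent-pair x∦z)
    ... | inj₁ refl        = independent-⊆ (removed (∪-swap ∘ ∪-⊆ (p⊆p∪q _ ∘ ∪-comm′) (q⊆p∪q _ _)))
                           (independent-pair y∦z)

  -- Three points of a line with distinct colours are pairwise non-parallel, because parallel points
  -- have equal colours; hence they form a three-element circuit.
  rainbow-free : ∀ {m} {c : Fin n → Fin m} → SimpleColouring M c → NoRainbowTriangle M c → RainbowFree geometry c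
  rainbow-free {c = c} (_ , parallel) no-triangle = record { parallel-colour = same ; line-colour = two }
    where
    same : ∀ {x y} → x ∥ y → c x ≡ c y
    same {x} {y} x∥y with x ≟ y
    ... | yes refl = refl
    ... | no x≢y   = parallel x y (x≢y , circuit-pair x≢y x∥y)

    two : ∀ {x y z} → c x ≢ c y → z ∈ line x y → c z ≡ c x ⊎ c z ≡ c y
    two {x} {y} {z} cx≢cy z∈ with c z ≟ c x | c z ≟ c y
    ... | yes eq | _ = inj₁ eq
    ... | no _ | yes eq = inj₂ eq
    ... | no cz≢cx | no cz≢cy = absurd (no-triangle (triple x y z)
          ( circuit-triple (cx≢cy ∘ cong c) (≢-sym cz≢cx ∘ cong c) (≢-sym cz≢cy ∘ cong c)
              (cx≢cy ∘ same) (≢-sym cz≢cx ∘ same) (≢-sym cz≢cy ∘ same) z∈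
          , ∣triple∣ (cx≢cy ∘ cong c) (≢-sym cz≢cx ∘ cong c) (≢-sym cz≢cy ∘ cong c)
          , injective ))
      where
      injective : ∀ e f → e ∈ triple x y z → f ∈ triple x y z → c e ≡ c f → e ≡ f
      injective e f e∈ f∈ eq with ∈-triple⁻ e∈ | ∈-triple⁻ f∈
      ... | inj₁ refl        | inj₁ refl        = refl
      ... | inj₁ refl        | inj₂ (inj₁ refl) = absurd (cx≢cy eq)
      ... | inj₁ refl        | inj₂ (inj₂ refl) = absurd (cz≢cx (sym eq))
      ... | inj₂ (inj₁ refl) | inj₁ refl        = absurd (cx≢cy (sym eq))
      ... | inj₂ (inj₁ refl) | inj₂ (inj₁ refl) = refl
      ... | inj₂ (inj₁ refl) | inj₂ (inj₂ refl) = absurd (cz≢cy (sym eq))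
      ... | inj₂ (inj₂ refl) | inj₁ refl        = absurd (cz≢cx eq)
      ... | inj₂ (inj₂ refl) | inj₂ (inj₁ refl) = absurd (cz≢cy eq)
      ... | inj₂ (inj₂ refl) | inj₂ (inj₂ refl) = refl

-- Dropping colours

sumOn : ∀ {m} → Subset m → (Fin m → ℕ) → ℕ
sumOn []          f = 0
sumOn (true  ∷ S) f = f zero + sumOn S (f ∘ suc)
sumOn (false ∷ S) f = sumOn S (f ∘ suc)

sumOn-+ : ∀ {m} (S : Subset m) f g → sumOn S (λ x → f x + g x) ≡ sumOn S f + sumOn S g
sumOn-+ []          f g = refl
sumOn-+ (false ∷ S) f g = sumOn-+ S (f ∘ suc) (g ∘ suc)
sumOn-+ (true  ∷ S) f g = trans (cong (f zero + g zero +_) (sumOn-+ S (f ∘ suc) (g ∘ suc)))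
  (interchange (f zero) (g zero) (sumOn S (f ∘ suc)) (sumOn S (g ∘ suc)))

sumOn-* : ∀ {m} (S : Subset m) k f → sumOn S (λ x → k * f x) ≡ k * sumOn S f
sumOn-* []          k f = sym (ℕ.*-zeroʳ k)
sumOn-* (false ∷ S) k f = sumOn-* S k (f ∘ suc)
sumOn-* (true  ∷ S) k f = trans (cong (k * f zero +_) (sumOn-* S k (f ∘ suc))) (sym (ℕ.*-distribˡ-+ k _ _))

sumOn-0 : ∀ {m} (S : Subset m) → sumOn S (λ _ → 0) ≡ 0
sumOn-0 []          = refl
sumOn-0 (true  ∷ S) = sumOn-0 S
sumOn-0 (false ∷ S) = sumOn-0 S

sumOn-≥ : ∀ {m} (S : Subset m) {f b} → (∀ {x} → x ∈ S → b ≤ f x) → ∣ S ∣ * b ≤ sumOn S f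
sumOn-≥ []          b≤ = z≤n
sumOn-≥ (true  ∷ S) b≤ = +-mono-≤ (b≤ here) (sumOn-≥ S (b≤ ∘ there))
sumOn-≥ (false ∷ S) b≤ = sumOn-≥ S (b≤ ∘ there)

below-average : ∀ {m} (S : Subset m) f → 0 < ∣ S ∣ → Σ[ x ∈ Fin m ] x ∈ S × ∣ S ∣ * f x ≤ sumOn S f
below-average S f 0<∣S∣ with any? (λ x → (x ∈? S) ×-dec (∣ S ∣ * f x ℕ.≤? sumOn S f))
... | yes found = found
... | no none = absurd (<⇒≱ (ℕ.*-monoʳ-< ∣ S ∣ {{>-nonZero 0<∣S∣}} (ℕ.n<1+n (sumOn S f))) (begin
      ∣ S ∣ * suc (sumOn S f)           ≤⟨ sumOn-≥ S (λ x∈S → ≰⇒> (λ le → none (_ , x∈S , le))) ⟩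
      sumOn S (λ x → ∣ S ∣ * f x)       ≡⟨ sumOn-* S ∣ S ∣ f ⟩
      ∣ S ∣ * sumOn S f                 ∎))
  where open ≤-Reasoning

point-mass : ∀ {m} → Fin m → ℕ → Fin m → ℕ
point-mass zero    w zero    = w
point-mass zero    w (suc x) = 0
point-mass (suc i) w zero    = 0
point-mass (suc i) w (suc x) = point-mass i w x

point-mass-self : ∀ {m} (i : Fin m) w → point-mass i w i ≡ w
point-mass-self zero    w = refl
point-mass-self (suc i) w = point-mass-self i w

sumOn-point-mass : ∀ {m} (S : Subset m) i w → sumOn S (point-mass i w) ≤ w
sumOn-point-mass (true  ∷ S) zero    w = ≤-reflexive (trans (cong (w +_) (sumOn-0 S)) (+-identityʳ w))
sumOn-point-mass (false ∷ S) zero    w = ≤-trans (≤-reflexive (sumOn-0 S)) z≤n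
sumOn-point-mass (true  ∷ S) (suc i) w = sumOn-point-mass S i w
sumOn-point-mass (false ∷ S) (suc i) w = sumOn-point-mass S i w

-- (w , i , j) is a layer of rank increment w whose points have colours i and j.
Item : ℕ → Set
Item m = ℕ × Fin m × Fin m

itemWeight : ∀ {m} → Item m → Subset m → ℕ
itemWeight (w , i , j) S with (i ∈? S) ×-dec (j ∈? S)
... | yes _ = w
... | no _  = 0

-- An upper bound for what the item loses when `x` is dropped from `S`; for equal `i` and `j` the
-- weight is counted twice.
itemLoss : ∀ {m} → Item m → Subset m → Fin m → ℕ
itemLoss (w , i , j) S x with (i ∈? S) ×-dec (j ∈? S)
... | yes _ = point-mass i w x + point-mass j w x
... | no _  = 0

weight : ∀ {m} → List (Item m) → Subset m → ℕ
weight []       S = 0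
weight (t ∷ ts) S = itemWeight t S + weight ts S

loss : ∀ {m} → List (Item m) → Subset m → Fin m → ℕ
loss []       S x = 0
loss (t ∷ ts) S x = itemLoss t S x + loss ts S x

itemWeight-≤ : ∀ {m} (t : Item m) S x → itemWeight t S ≤ itemWeight t (S - x) + itemLoss t S x
itemWeight-≤ (w , i , j) S x with (i ∈? S) ×-dec (j ∈? S) | (i ∈? (S - x)) ×-dec (j ∈? (S - x))
... | no _  | _     = z≤n
... | yes _ | yes _ = m≤m+n w _
... | yes (i∈S , j∈S) | no ¬both with i ≟ x
...   | yes refl = ≤-trans (≤-reflexive (sym (point-mass-self i w))) (m≤m+n _ _)
...   | no i≢x with j ≟ x
...     | yes refl = ≤-trans (≤-reflexive (sym (point-mass-self j w))) (ℕ.m≤n+m _ _)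
...     | no j≢x   = absurd (¬both (x∈p∧x≢y⇒x∈p-y i∈S i≢x , x∈p∧x≢y⇒x∈p-y j∈S j≢x))

weight-≤ : ∀ {m} (ts : List (Item m)) S x → weight ts S ≤ weight ts (S - x) + loss ts S x
weight-≤ []       S x = z≤n
weight-≤ (t ∷ ts) S x = ≤-trans (+-mono-≤ (itemWeight-≤ t S x) (weight-≤ ts S x))
  (≤-reflexive (interchange (itemWeight t (S - x)) (itemLoss t S x) (weight ts (S - x)) (loss ts S x)))

sumOn-itemLoss : ∀ {m} (t : Item m) S → sumOn S (itemLoss t S) ≤ 2 * itemWeight t S
sumOn-itemLoss (w , i , j) S with (i ∈? S) ×-dec (j ∈? S)
... | no _  = ≤-reflexive (sumOn-0 S)
... | yes _ = begin
  sumOn S (λ x → point-mass i w x + point-mass j w x)     ≡⟨ sumOn-+ S _ _ ⟩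
  sumOn S (point-mass i w) + sumOn S (point-mass j w)     ≤⟨ +-mono-≤ (sumOn-point-mass S i w)
                                                                      (sumOn-point-mass S j w) ⟩
  w + w                                                   ≡⟨ cong (w +_) (+-identityʳ w) ⟨
  2 * w                                                   ∎
  where open ≤-Reasoning

sumOn-loss : ∀ {m} (ts : List (Item m)) S → sumOn S (loss ts S) ≤ 2 * weight ts S
sumOn-loss []       S = ≤-reflexive (sumOn-0 S)
sumOn-loss (t ∷ ts) S = begin
  sumOn S (loss (t ∷ ts) S)                           ≡⟨ sumOn-+ S _ _ ⟩
  sumOn S (itemLoss t S) + sumOn S (loss ts S)        ≤⟨ +-mono-≤ (sumOn-itemLoss t S) (sumOn-loss ts S) ⟩
  2 * itemWeight t S + 2 * weight ts S                ≡⟨ ℕ.*-distribˡ-+ 2 (itemWeight t S) _ ⟨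
  2 * weight (t ∷ ts) S                               ∎
  where open ≤-Reasoning

-- Summed over `S`, the losses are at most twice the weight, as each item is charged to its two
-- colours. Some colour of `S` loses at most the average.
cheap-colour : ∀ {m} (ts : List (Item m)) S → 0 < ∣ S ∣ →
  Σ[ x ∈ Fin m ] x ∈ S × ∣ S ∣ * weight ts S ≤ ∣ S ∣ * weight ts (S - x) + 2 * weight ts S
cheap-colour ts S 0<∣S∣ with x , x∈S , le ← below-average S (loss ts S) 0<∣S∣ = x , x∈S , (begin
  ∣ S ∣ * weight ts S                                         ≤⟨ ℕ.*-monoʳ-≤ ∣ S ∣ (weight-≤ ts S x) ⟩
  ∣ S ∣ * (weight ts (S - x) + loss ts S x)                   ≡⟨ ℕ.*-distribˡ-+ ∣ S ∣ _ _ ⟩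
  ∣ S ∣ * weight ts (S - x) + ∣ S ∣ * loss ts S x             ≤⟨ +-monoʳ-≤ _ (≤-trans le (sumOn-loss ts S)) ⟩
  ∣ S ∣ * weight ts (S - x) + 2 * weight ts S                 ∎)
  where open ≤-Reasoning

[1+n]C2≡n+nC2 : ∀ n → suc n C 2 ≡ n + n C 2
[1+n]C2≡n+nC2 n = trans (sym (nCk+nC[k+1]≡[n+1]C[k+1] n 1)) (cong (_+ n C 2) (nC1≡n n))

2*[1+n]C2 : ∀ n → 2 * (suc n C 2) ≡ suc n * n
2*[1+n]C2 zero    = refl
2*[1+n]C2 (suc n) = begin
  2 * (suc (suc n) C 2)             ≡⟨ cong (2 *_) ([1+n]C2≡n+nC2 (suc n)) ⟩
  2 * (suc n + suc n C 2)           ≡⟨ ℕ.*-distribˡ-+ 2 (suc n) _ ⟩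
  2 * suc n + 2 * (suc n C 2)       ≡⟨ cong (2 * suc n +_) (2*[1+n]C2 n) ⟩
  2 * suc n + suc n * n             ≡⟨ arith n ⟩
  suc (suc n) * suc n               ∎
  where
  open ≡-Reasoning
  arith : ∀ n → 2 * suc n + suc n * n ≡ suc (suc n) * suc n
  arith = solve-∀

-- With `s = 2 + n` this is the ratio `(s - 2) / s` of consecutive binomials, the fraction of weight
-- that survives dropping a cheap colour.
[2+n]*[1+n]C2≡n*[2+n]C2 : ∀ n → (2 + n) * (suc n C 2) ≡ n * ((2 + n) C 2)
[2+n]*[1+n]C2≡n*[2+n]C2 n = ℕ.*-cancelˡ-≡ _ _ 2 (begin
  2 * ((2 + n) * (suc n C 2))   ≡⟨ x∙yz≈y∙xz 2 (2 + n) (suc n C 2) ⟩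
  (2 + n) * (2 * (suc n C 2))   ≡⟨ cong ((2 + n) *_) (2*[1+n]C2 n) ⟩
  (2 + n) * (suc n * n)         ≡⟨ arith n ⟩
  n * ((2 + n) * suc n)         ≡⟨ cong (n *_) (2*[1+n]C2 (suc n)) ⟨
  n * (2 * ((2 + n) C 2))       ≡⟨ x∙yz≈y∙xz n 2 ((2 + n) C 2) ⟩
  2 * (n * ((2 + n) C 2))       ∎)
  where
  open ≡-Reasoning
  arith : ∀ n → (2 + n) * (suc n * n) ≡ n * ((2 + n) * suc n)
  arith = solve-∀

-- Deleting a cheapest colour turns the weight bound for s colours into the one for s − 1.
averaging-step : ∀ u {w w′ w″ b} → (2 + u) * w ≤ (2 + u) * w′ + 2 * w → b * w′ ≤ w″ * (suc u C 2) →
                 .{{_ : NonZero u}} → b * w ≤ w″ * ((2 + u) C 2)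
averaging-step u {w} {w′} {w″} {b} le ih = ℕ.*-cancelˡ-≤ u (begin
  u * (b * w)                       ≡⟨ x∙yz≈y∙xz u b w ⟩
  b * (u * w)                       ≤⟨ ℕ.*-monoʳ-≤ b uw≤ ⟩
  b * ((2 + u) * w′)                ≡⟨ x∙yz≈y∙xz b (2 + u) w′ ⟩
  (2 + u) * (b * w′)                ≤⟨ ℕ.*-monoʳ-≤ (2 + u) ih ⟩
  (2 + u) * (w″ * (suc u C 2))      ≡⟨ x∙yz≈y∙xz (2 + u) w″ (suc u C 2) ⟩
  w″ * ((2 + u) * (suc u C 2))      ≡⟨ cong (w″ *_) ([2+n]*[1+n]C2≡n*[2+n]C2 u) ⟩
  w″ * (u * ((2 + u) C 2))          ≡⟨ x∙yz≈y∙xz w″ u ((2 + u) C 2) ⟩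
  u * (w″ * ((2 + u) C 2))          ∎)
  where
  open ≤-Reasoning
  uw≤ : u * w ≤ (2 + u) * w′
  uw≤ = +-cancelʳ-≤ (2 * w) _ _ (≤-trans (≤-reflexive (split u w)) le)
    where
    split : ∀ u w → u * w + 2 * w ≡ (2 + u) * w
    split = solve-∀

small-C2 : ∀ {ℓ} → ℓ ≤ 1 → ℓ C 2 ≡ 0
small-C2 z≤n       = refl
small-C2 (s≤s z≤n) = refl

∣p-x∣+1≡∣p∣ : ∀ {m} {S : Subset m} {x t} → x ∈ S → ∣ S ∣ ≡ suc t → ∣ S - x ∣ ≡ t
∣p-x∣+1≡∣p∣ {S = S} {x} x∈S eq = ℕ.≤-antisym
  (ℕ.≤-pred (subst (∣ S - x ∣ <_) eq (x∈p⇒∣p-x∣<∣p∣ x∈S)))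
  (ℕ.≤-pred (subst (_≤ suc ∣ S - x ∣) eq (∣p∣≤1+∣p-x∣ S x)))

heavy-subset : ∀ {m} (ts : List (Item m)) ℓ d S → ∣ S ∣ ≡ d + ℓ →
  Σ[ S′ ∈ Subset m ] ∣ S′ ∣ ≤ ℓ × (ℓ C 2) * weight ts S ≤ weight ts S′ * ((d + ℓ) C 2)
heavy-subset ts ℓ zero S eq = S , ≤-reflexive eq , ≤-reflexive (ℕ.*-comm (ℓ C 2) _)
heavy-subset {m} ts ℓ (suc d) S eq = go (d + ℓ) refl
  where
  trivial : ℓ ≤ 1 → Σ[ S′ ∈ Subset m ] ∣ S′ ∣ ≤ ℓ × (ℓ C 2) * weight ts S ≤ weight ts S′ * ((suc d + ℓ) C 2)
  trivial ℓ≤1 = ⊥ , ≤-trans (≤-reflexive (∣⊥∣≡0 m)) z≤n ,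
    ≤-trans (≤-reflexive (cong (_* weight ts S) (small-C2 ℓ≤1))) z≤n

  go : ∀ t → d + ℓ ≡ t → Σ[ S′ ∈ Subset m ] ∣ S′ ∣ ≤ ℓ × (ℓ C 2) * weight ts S ≤ weight ts S′ * ((suc d + ℓ) C 2)
  -- `S` has at most two colours, so there is no positive factor `∣ S ∣ - 2` for `averaging-step` to
  -- cancel. But then `ℓ ≤ 1`, hence `ℓ C 2` vanishes and the empty set serves.
  go zero          eq′ = trivial (≤-trans (ℕ.m≤n+m ℓ d) (≤-trans (≤-reflexive eq′) z≤n))
  go (suc zero)    eq′ = trivial (≤-trans (ℕ.m≤n+m ℓ d) (≤-reflexive eq′))
  go (suc (suc u)) eq′
    with x , x∈S , le ← cheap-colour ts S (subst (0 <_) (sym eq) (s≤s z≤n))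
    with S′ , ∣S′∣≤ℓ , ih ← heavy-subset ts ℓ d (S - x) (∣p-x∣+1≡∣p∣ x∈S eq)
    rewrite eq′ | eq
    = S′ , ∣S′∣≤ℓ , averaging-step (suc u) {w″ = weight ts S′} {b = ℓ C 2} le ih

in-image? : ∀ {n m} (c : Fin n → Fin m) F j → Dec (∃ λ e → e ∈ F × c e ≡ j)
in-image? c F j = any? (λ e → (e ∈? F) ×-dec (c e ≟ j))

image-⊆ : ∀ {n m} (c : Fin n → Fin m) {F S} → (∀ {x} → x ∈ F → c x ∈ S) → image c F ⊆ S
image-⊆ c {F} {S} F→S j∈ with x , x∈F , cx≡j ← ∈-sieve⁻ (in-image? c F) j∈ = subst (_∈ S) cx≡j (F→S x∈F)

-- Assembling the layers into a flat

module Decomposition {n m : ℕ} (M : Matroid n) (c : Fin n → Fin m) (noLoop : ∀ e → ¬ IsLoop M e)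
                     (modular : Modular M) (connected : Connected M)
                     (simple : SimpleColouring M c) (no-triangle : NoRainbowTriangle M c) where
  open MatroidClosure M using (rk; rank-⊆-cl; rank-empty; flat⇒isFlat; isFlat⇒flat)
  open MatroidClosure.Loopless.Modularity M noLoop modular using (modular-flats)
  open MatroidGeometry M noLoop modular connected
  open Subspaces geometry
  open TopLayer (rainbow-free simple no-triangle)

  Coloured-within : List (Item m) → Subset n → Subset m → Set
  Coloured-within ts K S =
    Σ[ G ∈ Subset n ] Flat G × G ⊆ K × (∀ {x} → x ∈ G → c x ∈ S) × weight ts S ≤ rk G

  colour-used : ∀ x → c x ∈ image c ⊤
  colour-used x = ∈-sieve⁺ (in-image? c ⊤) (x , ∈⊤ , refl)

  -- If both colours are in `S`, a complement of `F` in `K` above `G` is taken: it meets `F` only in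
  -- `G` and otherwise lies in the layer, so its colours are in `S`, and modularity bounds its rank.
  -- If not, the weight is unchanged and `G` is kept.
  add-layer : ∀ ts {K S} → Flat K → (L : TwoColouredLayer K) → let open TwoColouredLayer L in
    Coloured-within ts set S → Coloured-within ((rk K ∸ rk set , c p , c q) ∷ ts) K S
  add-layer ts {K} {S} fK L (G , fG , G⊆F , G-colours , le)
    with (c (TwoColouredLayer.p L) ∈? S) ×-dec (c (TwoColouredLayer.q L) ∈? S)
  ... | no _ = G , fG , TwoColouredLayer.below L ∘ G⊆F , G-colours , le
  ... | yes (p∈S , q∈S) = N.set , N.flat , N.below , colours-in-S , rank-bound
    where
    open TwoColouredLayer L renaming (set to F)
    module N = Complement (complement {G} {F} {K} fG flat fK (below ∘ G⊆F))
    open ≤-Reasoning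
    colours-in-S : ∀ {x} → x ∈ N.set → c x ∈ S
    colours-in-S {x} x∈ with x ∈? F
    ... | yes x∈F = G-colours (N.meet x∈ x∈F)
    ... | no x∉F with colours (N.below x∈) x∉F
    ...   | inj₁ cx≡cp = subst (_∈ S) (sym cx≡cp) p∈S
    ...   | inj₂ cx≡cq = subst (_∈ S) (sym cx≡cq) q∈S
    rank-bound : rk K ∸ rk F + weight ts S ≤ rk N.set
    rank-bound = +-cancelʳ-≤ (rk F) _ _ (begin
      rk K ∸ rk F + weight ts S + rk F       ≡⟨ ℕ.+-assoc (rk K ∸ rk F) _ _ ⟩
      rk K ∸ rk F + (weight ts S + rk F)     ≡⟨ cong (rk K ∸ rk F +_) (+-comm (weight ts S) _) ⟩
      rk K ∸ rk F + (rk F + weight ts S)     ≡⟨ ℕ.+-assoc (rk K ∸ rk F) _ _ ⟨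
      rk K ∸ rk F + rk F + weight ts S       ≡⟨ cong (_+ weight ts S) (ℕ.m∸n+n≡m (r-mono M _ _ below)) ⟩
      rk K + weight ts S                     ≤⟨ +-mono-≤ (rank-⊆-cl N.spans) (≤-trans le (r-mono M _ _ G⊆)) ⟩
      rk (N.set ∪ F) + rk (N.set ∩ F)        ≡⟨ modular-flats N.flat flat ⟨
      rk N.set + rk F                        ∎)
      where
      G⊆ : G ⊆ N.set ∩ F
      G⊆ x∈G = x∈p∩q⁺ (N.above x∈G , G⊆F x∈G)

  -- The rank increments telescope to `rk K`, and all of them count because the colours of each
  -- layer are colours of points.
  decompose : ∀ K → Acc _<_ ∣ K ∣ → Flat K →
    Σ[ ts ∈ List (Item m) ] rk K ≤ weight ts (image c ⊤) × (∀ S → Coloured-within ts K S)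
  decompose K (acc rec) fK with nonempty? K
  ... | no empty = [] , ≤-reflexive (rank-empty empty) , λ S →
        ⊥ , flat-⊥ , absurd ∘ ∉⊥ , absurd ∘ ∉⊥ , z≤n
  ... | yes ne
    with L ← top-layer K (<-wellFounded _) fK ne
    with ts , total , within ← decompose (TwoColouredLayer.set L)
           (rec (p⊂q⇒∣p∣<∣q∣ (TwoColouredLayer.below L , _ ,
              TwoColouredLayer.missing∈K L , TwoColouredLayer.missing∉ L)))
           (TwoColouredLayer.flat L)
    = (rk K ∸ rk F , c p , c q) ∷ ts , total′ , λ S → add-layer ts fK L (within S)
    where
    open TwoColouredLayer L renaming (set to F)
    total′ : rk K ≤ weight ((rk K ∸ rk F , c p , c q) ∷ ts) (image c ⊤)
    total′ with (c p ∈? image c ⊤) ×-dec (c q ∈? image c ⊤)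
    ... | no unused = absurd (unused (colour-used p , colour-used q))
    ... | yes _ = ≤-trans (≤-reflexive (sym (ℕ.m∸n+n≡m (r-mono M _ _ below)))) (+-monoʳ-≤ (rk K ∸ rk F) total)

theorem8p3 : (ℓ k : ℕ) → ℓ ≤ k → 2 ≤ k →
    {n m : ℕ} (M : Matroid n) (c : Fin n → Fin m) →
    Connected M → Modular M → SimpleColouring M c → NoRainbowTriangle M c →
    numColours c ≡ k →
    Σ (Subset n) λ F → IsFlat M F × ∣ image c F ∣ ≤ ℓ
    × (ℓ C 2) * rankM M ≤ r M F * (k C 2)
theorem8p3 ℓ k ℓ≤k _ M c connected modular simple no-triangle colours≡k
  with ts , total , within ← Decomposition.decompose M c (proj₁ simple) modular connected simple no-triangle
         ⊤ (<-wellFounded _) (λ _ → ∈⊤)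
  -- Of the `k` colours in use, `k ∸ ℓ` are dropped; `within` then turns the remaining weight into
  -- the rank of a flat.
  with S , ∣S∣≤ℓ , heavy ← heavy-subset ts ℓ (k ∸ ℓ) (image c ⊤) (trans colours≡k (sym (ℕ.m∸n+n≡m ℓ≤k)))
  with F , fF , _ , F-colours , le ← within S
  = F , MatroidClosure.flat⇒isFlat M fF , ≤-trans (p⊆q⇒∣p∣≤∣q∣ (image-⊆ c F-colours)) ∣S∣≤ℓ , (begin
    (ℓ C 2) * rankM M                       ≤⟨ ℕ.*-monoʳ-≤ (ℓ C 2) total ⟩
    (ℓ C 2) * weight ts (image c ⊤)         ≤⟨ heavy ⟩
    weight ts S * ((k ∸ ℓ + ℓ) C 2)         ≡⟨ cong (λ j → weight ts S * (j C 2)) (ℕ.m∸n+n≡m ℓ≤k) ⟩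
    weight ts S * (k C 2)                   ≤⟨ ℕ.*-monoˡ-≤ (k C 2) le ⟩
    r M F * (k C 2)                         ∎)
  where open ≤-Reasoning
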